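{- Let $k\ge2$, let $\Pi\subseteq\mathfrak S_k$ be a nonoverlapping set of patterns, and let $I$ be a finite set of positive integers with $m=\max(I\cup\{0\})$. Then there is a function $g$ in the $\mathbb Q$-vector space $V_\Pi$ spanned by the functions $n\mapsto n^{j}\,\mathrm{av}_\Pi(n+l)$ ($j\in\mathbb Z_{\ge0}$, $l\in\mathbb Z$) such that $\#\Pi(I;n)=g(n)$ for all integers $n\ge m+k-1$.
   Context: Two integer sequences $a_1\cdots a_k$ and $b_1\cdots b_k$ are order isomorphic if $a_i<a_j\iff b_i<b_j$ for all $i,j$. For $\sigma\in\mathfrak S_k$, a permutation $\pi\in\mathfrak S_n$ contains a consecutive copy of $\sigma$ at index $i$ if $\pi_i\pi_{i+1}\cdots\pi_{i+k-1}$ is order isomorphic to $\sigma$. For a set $\Pi$ of patterns, $\Pi(I;n)$ is the set of $\pi\in\mathfrak S_n$ such that the set of indices $i$ at which $\pi$ contains a consecutive copy of some $\sigma\in\Pi$ is exactly $I$, and $\mathrm{av}_\Pi(n)=\#\Pi(\emptyset;n)$ (with $\mathrm{av}_\Pi(n)$ understood as $\#\Pi(\emptyset;n)$ for all integers $n\ge0$). $\Pi\subseteq\mathfrak S_k$ is nonoverlapping if for all (not necessarily distinct) $\sigma,\tau\in\Pi$ and every $l$ with $1<l<k$, the length-$l$ prefix of $\sigma$ is not order isomorphic to the length-$l$ suffix of $\tau$. -}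

module Defs where

open import Data.Empty using (⊥)
open import Data.Fin.Base as Fin using (Fin; inject≤; _↑ʳ_)
import Data.Fin.Properties as Fin
open import Data.Integer.Base as ℤ using (ℤ; +_; -[1+_])
open import Data.List.Base
  using (List; []; _∷_; filter; length; cartesianProductWith; allFin)
open import Data.List.Membership.DecPropositional using (_∈?_)
open import Data.List.Membership.Propositional using (_∈_)
open import Data.List.Relation.Unary.All as All using (All)
open import Data.List.Relation.Unary.Any as Any using (Any)
open import Data.Nat.Base using (ℕ; zero; suc; _+_; _∸_; _≤_; _<_; s≤s)
open import Data.Nat.Properties
  using (_≤?_; _≟_; allUpTo?; ≤-trans; ≤-reflexive; <⇒≤; m≤m+n; m∸n+n≡m)
open import Data.Product.Base using (Σ-syntax; ∃; _×_; _,_; proj₁; proj₂)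
open import Data.Rational.Base as ℚ using (ℚ; 0ℚ)
open import Data.Vec.Base as Vec using (Vec; lookup)
open import Data.Vec.Functional using (Vector)
open import Data.Vec.Relation.Unary.AllPairs using (allPairs?)
open import Data.Vec.Relation.Unary.Unique.Propositional using (Unique)
open import Function.Bundles using (_⇔_; mk⇔; module Equivalence)
open import Relation.Binary.PropositionalEquality.Core using (_≡_)
open import Relation.Nullary using (Dec; yes; no; ¬_; ¬?; map′; _×-dec_; _→-dec_)
open import Relation.Unary using (Decidable)

-- Permutations are in one-line notation.  The values of a permutation of
-- size n are 0, …, n - 1 rather than 1, …, n; only their order matters.

IsPermutation : ∀ {n} → Vec (Fin n) n → Set
IsPermutation = Unique

isPermutation? : ∀ {n} → Decidable (IsPermutation {n})
isPermutation? = allPairs? (λ x y → ¬? (x Fin.≟ y))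

-- Every vector of length l over Fin n, listed exactly once.
words : ∀ n l → List (Vec (Fin n) l)
words n zero    = Vec.[] ∷ []
words n (suc l) = cartesianProductWith Vec._∷_ (allFin n) (words n l)

𝔖 : ∀ n → List (Vec (Fin n) n)
𝔖 n = filter isPermutation? (words n n)

OrderIsomorphic : ∀ {l m n} → Vector (Fin m) l → Vector (Fin n) l → Set
OrderIsomorphic a b = ∀ i j → a i Fin.< a j ⇔ b i Fin.< b j

-- The l consecutive entries that follow the first s entries.
factor : ∀ {A : Set} {n} s l → s + l ≤ n → Vec A n → Vector A l
factor s l s+l≤n xs j = lookup xs (inject≤ (s ↑ʳ j) s+l≤n)

prefix : ∀ {A : Set} {n} l → l ≤ n → Vec A n → Vector A l
prefix l l≤n = factor 0 l l≤n

suffix : ∀ {A : Set} {n} l → l ≤ n → Vec A n → Vector A l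
suffix {n = n} l l≤n = factor (n ∸ l) l (≤-reflexive (m∸n+n≡m l≤n))

-- A set of patterns is given as a list; order and repetitions in the list
-- are irrelevant, as only membership in it is ever used.

Nonoverlapping : ∀ {k} → List (Vec (Fin k) k) → Set
Nonoverlapping {k} Π =
  ∀ {σ τ} → σ ∈ Π → τ ∈ Π → ∀ l → 1 < l → (l<k : l < k) →
  ¬ OrderIsomorphic (prefix l (<⇒≤ l<k) σ) (suffix l (<⇒≤ l<k) τ)

-- Indices start at 1.
ContainsAt : ∀ {k n} → Vec (Fin k) k → Vec (Fin n) n → ℕ → Set
ContainsAt         σ π zero    = ⊥
ContainsAt {k} {n} σ π (suc s) =
  Σ[ s+k≤n ∈ s + k ≤ n ] OrderIsomorphic (factor s k s+k≤n π) (lookup σ)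

ContainsSomeAt : ∀ {k n} → List (Vec (Fin k) k) → Vec (Fin n) n → ℕ → Set
ContainsSomeAt Π π i = Any (λ σ → ContainsAt σ π i) Π

HasIndexSet : ∀ {k n} → List (Vec (Fin k) k) → List ℕ → Vec (Fin n) n → Set
HasIndexSet Π I π = ∀ i → ContainsSomeAt Π π i ⇔ i ∈ I

orderIsomorphic? : ∀ {l m n} (a : Vector (Fin m) l) (b : Vector (Fin n) l) →
                   Dec (OrderIsomorphic a b)
orderIsomorphic? a b = Fin.all? λ i → Fin.all? λ j →
  map′ (λ (f , g) → mk⇔ f g) (λ e → Equivalence.to e , Equivalence.from e)
    ((a i Fin.<? a j →-dec b i Fin.<? b j) ×-dec
     (b i Fin.<? b j →-dec a i Fin.<? a j))

containsAt? : ∀ {k n} (σ : Vec (Fin k) k) (π : Vec (Fin n) n) i →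
              Dec (ContainsAt σ π i)
containsAt?         σ π zero    = no λ ()
containsAt? {k} {n} σ π (suc s) with s + k ≤? n
... | yes s+k≤n = map′ (s+k≤n ,_) proj₂
                    (orderIsomorphic? (factor s k s+k≤n π) (lookup σ))
... | no  s+k≰n = no λ (s+k≤n , _) → s+k≰n s+k≤n

containsSomeAt? : ∀ {k n} (Π : List (Vec (Fin k) k)) (π : Vec (Fin n) n) i →
                  Dec (ContainsSomeAt Π π i)
containsSomeAt? Π π i = Any.any? (λ σ → containsAt? σ π i) Π

containsAt-bound : ∀ {k n} {σ : Vec (Fin k) k} {π : Vec (Fin n) n} i →
                   ContainsAt σ π i → i < 2 + n
containsAt-bound {k} (suc s) (s+k≤n , _) = s≤s (s≤s (≤-trans (m≤m+n s k) s+k≤n))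

hasIndexSet? : ∀ {k n} (Π : List (Vec (Fin k) k)) (I : List ℕ) →
               Decidable (HasIndexSet {n = n} Π I)
hasIndexSet? {n = n} Π I π =
  map′ (λ (f , g) i → mk⇔ (λ c → f (bound i c) c) (All.lookup g))
       (λ h → (λ {i} _ → Equivalence.to (h i)) ,
              All.tabulate (λ {i} → Equivalence.from (h i)))
    (allUpTo? (λ i → containsSomeAt? Π π i →-dec _∈?_ _≟_ i I) (2 + n) ×-dec
     All.all? (containsSomeAt? Π π) I)
  where
  bound : ∀ i → ContainsSomeAt Π π i → i < 2 + n
  bound i c = containsAt-bound i (proj₂ (Any.satisfied c))

permutationsWithIndexSet : ∀ {k} → List (Vec (Fin k) k) → List ℕ →
                           ∀ n → List (Vec (Fin n) n)
permutationsWithIndexSet Π I n = filter (hasIndexSet? Π I) (𝔖 n)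

#_⟨_⨾_⟩ : ∀ {k} → List (Vec (Fin k) k) → List ℕ → ℕ → ℕ
# Π ⟨ I ⨾ n ⟩ = length (permutationsWithIndexSet Π I n)

-- Extended by 0 to negative sizes, for which there are no permutations, so
-- that n ↦ av Π (n + l) is defined for every integer shift l.
av : ∀ {k} → List (Vec (Fin k) k) → ℤ → ℕ
av Π (+ n)    = # Π ⟨ [] ⨾ n ⟩
av Π -[1+ _ ] = 0

linearCombination : ∀ {X J : Set} → (J → X → ℚ) → List (ℚ × J) → X → ℚ
linearCombination f []             x = 0ℚ
linearCombination f ((c , j) ∷ ts) x =
  c ℚ.* f j x ℚ.+ linearCombination f ts x

-- Membership in the ℚ-linear span of a family of functions.
_∈Span_ : ∀ {X J : Set} → (X → ℚ) → (J → X → ℚ) → Set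
g ∈Span f = ∃ λ ts → ∀ x → g x ≡ linearCombination f ts x

generator : ∀ {k} → List (Vec (Fin k) k) → ℕ × ℤ → ℤ → ℚ
generator Π (j , l) n = (n ℤ.^ j ℤ.* + av Π (n ℤ.+ l)) ℚ./ 1

V : ∀ {k} → List (Vec (Fin k) k) → (ℤ → ℚ) → Set
V Π g = g ∈Span generator Π

{-# OPTIONS --safe #-}
-- Let a = max I and J = I \ {a}.  If some element of J exceeds a - k + 1, no
-- permutation has index set I, as its occurrence would overlap the one at a.
-- Otherwise count the permutations of size n whose first a entries have index
-- set J and whose last n - a entries avoid Π: choosing the values of the first
-- a entries, there are C(n, a) #Π(J; a) av_Π(n - a) of them.  At most one
-- occurrence straddles the cut, so their index sets are J or J ∪ {s} with
-- a - k + 2 ≤ s ≤ a.  Solving for the term s = a expresses #Π(I; n) through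
-- #Π(J; n) and the #Π(J ∪ {s}; n) with s < a, which are covered by induction
-- on the maximum.

module Submission where

open import Defs
import Algebra.Properties.CommutativeSemigroup as CommutativeSemigroup
open import Data.Fin.Base as Fin using (Fin; toℕ; inject≤; _↑ʳ_)
import Data.Fin.Properties as Fin
open import Data.List.Base
  using (List; []; _∷_; _++_; map; filter; length; concatMap;
         cartesianProductWith; allFin; applyUpTo; lookup)
open import Data.List.Extrema.Nat using (max; xs≤max)
import Data.List.Membership.DecPropositional as DecMembership
open import Data.List.Membership.Propositional using (_∈_; _∉_; find; lose)
open import Data.List.Membership.Propositional.Properties
  using (∈-++⁺ˡ; ∈-++⁺ʳ; ∈-++⁻; ∈-map⁺; ∈-map⁻; ∈-filter⁺; ∈-filter⁻;
         ∈-applyUpTo⁺; ∈-applyUpTo⁻; ∈-allFin; ∈-lookup)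
open import Data.List.Properties
  using (map-++; map-∘; length-map; length-++; length-tabulate;
         map-tabulate; tabulate-lookup)
open import Data.List.Relation.Binary.Permutation.Propositional
  using (_↭_; ↭-refl; ↭-trans; ↭-sym; ↭⇒↭ₛ; prep; swap)
import Data.List.Relation.Binary.Permutation.Propositional.Properties as ↭
import Data.List.Relation.Binary.Permutation.Setoid.Properties as ↭ₛ
open import Data.List.Relation.Unary.All as All using (All; []; _∷_)
import Data.List.Relation.Unary.All.Properties as All
open import Data.List.Relation.Unary.AllPairs using (AllPairs; []; _∷_)
import Data.List.Relation.Unary.AllPairs.Properties as AllPairs
open import Data.List.Relation.Unary.Any as Any using (Any; here; there; any?)
open import Data.List.Relation.Unary.Unique.Propositional as List using ()
import Data.List.Relation.Unary.Unique.Propositional.Properties as Unique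
open import Data.Nat.Base hiding (_/_)
open import Data.Nat.Combinatorics
  using (_C_; nCn≡1; nCk≡nC[n∸k]; nC1≡n; nCk+nC[k+1]≡[n+1]C[k+1])
open import Data.Nat.ListAction using (sum)
open import Data.Nat.ListAction.Properties using (sum-++)
open import Data.Nat.Properties
import Data.Nat.Tactic.RingSolver as ℕ-Ring
open import Data.Product.Base using (Σ-syntax; ∃; _×_; _,_; proj₁; proj₂)
open import Data.Sum.Base using (inj₁; inj₂)
open import Data.Vec.Base as Vec using (Vec; []; _∷_)
open import Data.Vec.Functional using (Vector)
import Data.Vec.Properties as Vec
import Data.Vec.Relation.Unary.All as VecAll
import Data.Vec.Relation.Unary.AllPairs as VecAllPairs
import Data.Vec.Relation.Unary.Unique.Propositional as Vec
open import Function.Base using (_∘_; id)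
open import Function.Bundles using (_⇔_; mk⇔; module Equivalence)
open import Function.Properties.Equivalence
  using () renaming (sym to ⇔-sym; trans to ⇔-trans)
open import Relation.Binary.Definitions using (DecidableEquality; tri<; tri≈; tri>)
open import Relation.Binary.PropositionalEquality hiding (J)
open import Relation.Nullary
  using (Dec; yes; no; ¬_; ¬?; map′; _×-dec_; _→-dec_; contradiction)
open import Relation.Unary using (Decidable)

open CommutativeSemigroup +-commutativeSemigroup using (interchange)
open Equivalence using (to; from)

-- The cut is placed after entry a because a is the last index at which an occurrence can straddle
-- it: every other straddling index is smaller, which is what lets the induction on the maximum go
-- through. Two occurrences across the same cut both contain the entries next to it, so they share
-- at least two entries, which nonoverlapping patterns forbid. In the product C(n, a) #Π(J; a)
-- av_Π(n - a), the middle factor does not depend on n and C(n, a) is a polynomial in n, so the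
-- product lies in the span. The obstacle is that the two blocks of a permutation are words over a
-- larger alphabet. Relations between counts are additive identities in ℕ; counts are subtracted,
-- and divided by constants, only in ℚ.

private variable
  A B P Q R : Set
  l m n p : ℕ

-- Sums over lists and indicators

∑ : List A → (A → ℕ) → ℕ
∑ xs f = sum (map f xs)

infix 5 ∑
syntax ∑ xs (λ x → e) = ∑[ x ← xs ] e

⟦_⟧ : Dec P → ℕ
⟦ yes _ ⟧ = 1
⟦ no  _ ⟧ = 0

⟦⟧-cong : (p? : Dec P) (q? : Dec Q) → (P → Q) → (Q → P) → ⟦ p? ⟧ ≡ ⟦ q? ⟧
⟦⟧-cong (yes p) (yes q) f g = refl
⟦⟧-cong (yes p) (no ¬q) f g = contradiction (f p) ¬q
⟦⟧-cong (no ¬p) (yes q) f g = contradiction (g q) ¬p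
⟦⟧-cong (no ¬p) (no ¬q) f g = refl

⟦⟧-yes : (p? : Dec P) → P → ⟦ p? ⟧ ≡ 1
⟦⟧-yes (yes _) _ = refl
⟦⟧-yes (no ¬p) p = contradiction p ¬p

⟦⟧-no : (p? : Dec P) → ¬ P → ⟦ p? ⟧ ≡ 0
⟦⟧-no (yes p) ¬p = contradiction p ¬p
⟦⟧-no (no _)  _  = refl

⟦⟧-* : (p? : Dec P) (q? : Dec Q) (r? : Dec R) →
       (P → Q × R) → (Q × R → P) → ⟦ p? ⟧ ≡ ⟦ q? ⟧ * ⟦ r? ⟧
⟦⟧-* p? (yes q) (yes r) f g = ⟦⟧-yes p? (g (q , r))
⟦⟧-* p? (yes q) (no ¬r) f g = ⟦⟧-no p? (¬r ∘ proj₂ ∘ f)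
⟦⟧-* p? (no ¬q) r?      f g = ⟦⟧-no p? (¬q ∘ proj₁ ∘ f)

∑-cong-All : ∀ {xs : List A} {f g : A → ℕ} → All (λ x → f x ≡ g x) xs →
             ∑ xs f ≡ ∑ xs g
∑-cong-All []         = refl
∑-cong-All (eq ∷ eqs) = cong₂ _+_ eq (∑-cong-All eqs)

∑-cong : ∀ (xs : List A) {f g : A → ℕ} → (∀ x → f x ≡ g x) → ∑ xs f ≡ ∑ xs g
∑-cong xs eq = ∑-cong-All (All.universal eq xs)

∑-++ : ∀ xs ys (f : A → ℕ) → ∑ (xs ++ ys) f ≡ ∑ xs f + ∑ ys f
∑-++ xs ys f = trans (cong sum (map-++ f xs ys)) (sum-++ (map f xs) (map f ys))

∑-map : ∀ (h : A → B) xs (f : B → ℕ) → ∑ (map h xs) f ≡ ∑ xs (f ∘ h)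
∑-map h xs f = cong sum (sym (map-∘ xs))

∑-concatMap : ∀ (h : A → List B) xs (f : B → ℕ) →
              ∑ (concatMap h xs) f ≡ (∑[ x ← xs ] ∑ (h x) f)
∑-concatMap h []       f = refl
∑-concatMap h (x ∷ xs) f =
  trans (∑-++ (h x) (concatMap h xs) f) (cong (∑ (h x) f +_) (∑-concatMap h xs f))

∑-zero : ∀ (xs : List A) → (∑[ _ ← xs ] 0) ≡ 0
∑-zero []       = refl
∑-zero (_ ∷ xs) = ∑-zero xs

∑-const : ∀ (xs : List A) c → (∑[ _ ← xs ] c) ≡ length xs * c
∑-const []       c = refl
∑-const (_ ∷ xs) c = cong (c +_) (∑-const xs c)

∑-*ʳ : ∀ (xs : List A) f c → (∑[ x ← xs ] f x * c) ≡ ∑ xs f * c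
∑-*ʳ []       f c = refl
∑-*ʳ (x ∷ xs) f c =
  trans (cong (f x * c +_) (∑-*ʳ xs f c)) (sym (*-distribʳ-+ c (f x) (∑ xs f)))

∑-*ˡ : ∀ (xs : List A) c f → (∑[ x ← xs ] c * f x) ≡ c * ∑ xs f
∑-*ˡ xs c f = trans (∑-cong xs λ x → *-comm c (f x))
              (trans (∑-*ʳ xs f c) (*-comm (∑ xs f) c))

∑-+ : ∀ (xs : List A) f g → (∑[ x ← xs ] f x + g x) ≡ ∑ xs f + ∑ xs g
∑-+ []       f g = refl
∑-+ (x ∷ xs) f g = trans (cong (f x + g x +_) (∑-+ xs f g))
                         (interchange (f x) (g x) (∑ xs f) (∑ xs g))

∑-swap : ∀ (xs : List A) (ys : List B) (f : A → B → ℕ) →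
         (∑[ x ← xs ] ∑[ y ← ys ] f x y) ≡ (∑[ y ← ys ] ∑[ x ← xs ] f x y)
∑-swap []       ys f = sym (∑-zero ys)
∑-swap (x ∷ xs) ys f = trans (cong (∑ ys (f x) +_) (∑-swap xs ys f))
                             (sym (∑-+ ys (f x) _))

∑-filter : ∀ {P : A → Set} (P? : Decidable P) xs f →
           ∑ (filter P? xs) f ≡ (∑[ x ← xs ] ⟦ P? x ⟧ * f x)
∑-filter P? []       f = refl
∑-filter P? (x ∷ xs) f with P? x
... | yes _ = cong₂ _+_ (sym (*-identityˡ (f x))) (∑-filter P? xs f)
... | no  _ = ∑-filter P? xs f

length-filter : ∀ {P : A → Set} (P? : Decidable P) xs →
                length (filter P? xs) ≡ (∑[ x ← xs ] ⟦ P? x ⟧)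
length-filter P? []       = refl
length-filter P? (x ∷ xs) with P? x
... | yes _ = cong suc (length-filter P? xs)
... | no  _ = length-filter P? xs

∑-cartesianProductWith : ∀ {C : Set} (h : A → B → C) xs ys f →
  ∑ (cartesianProductWith h xs ys) f ≡ (∑[ x ← xs ] ∑[ y ← ys ] f (h x y))
∑-cartesianProductWith h []       ys f = refl
∑-cartesianProductWith h (x ∷ xs) ys f =
  trans (∑-++ (map (h x) ys) _ f)
        (cong₂ _+_ (∑-map (h x) ys f) (∑-cartesianProductWith h xs ys f))

module _ (_≟A_ : DecidableEquality A) where

  ∑-δ-∉ : ∀ {xs} {y : A} → y ∉ xs → (∑[ x ← xs ] ⟦ x ≟A y ⟧) ≡ 0
  ∑-δ-∉ {[]}     y∉ = refl
  ∑-δ-∉ {x ∷ xs} y∉ = cong₂ _+_ (⟦⟧-no (x ≟A _) (y∉ ∘ here ∘ sym)) (∑-δ-∉ (y∉ ∘ there))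

  ∑-δ-∈ : ∀ {xs} {y : A} → List.Unique xs → y ∈ xs → (∑[ x ← xs ] ⟦ x ≟A y ⟧) ≡ 1
  ∑-δ-∈ (x∉xs ∷ _) (here refl) =
    cong₂ _+_ (⟦⟧-yes (_ ≟A _) refl) (∑-δ-∉ (All.All¬⇒¬Any x∉xs))
  ∑-δ-∈ {x ∷ _} (x∉xs ∷ uniq) (there y∈xs) =
    cong₂ _+_ (⟦⟧-no (x ≟A _) λ { refl → All.All¬⇒¬Any x∉xs y∈xs }) (∑-δ-∈ uniq y∈xs)

  -- Both sides equal the double sum of `⟦ x ≟A y ⟧ * f y`: uniqueness of `ys` collapses it to the
  -- sum over `xs`, as `f` vanishes off `ys`, and uniqueness of `xs` to the sum over `ys`. It
  -- restricts a sum over the whole alphabet to the permitted letters.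
  ∑-⊆ : ∀ {xs ys : List A} → List.Unique xs → List.Unique ys → (∀ {y} → y ∈ ys → y ∈ xs) →
        ∀ f → (∀ x → x ∉ ys → f x ≡ 0) → ∑ xs f ≡ ∑ ys f
  ∑-⊆ {xs} {ys} !xs !ys ys⊆xs f f≡0 = begin
    (∑[ x ← xs ] f x)                            ≡⟨ ∑-cong xs expand ⟩
    (∑[ x ← xs ] ∑[ y ← ys ] ⟦ x ≟A y ⟧ * f y)   ≡⟨ ∑-swap xs ys _ ⟩
    (∑[ y ← ys ] ∑[ x ← xs ] ⟦ x ≟A y ⟧ * f y)   ≡⟨ ∑-cong-All (All.tabulate collapse) ⟩
    (∑[ y ← ys ] f y)                            ∎
    where
    open ≡-Reasoning
    collapse : ∀ {y} → y ∈ ys → (∑[ x ← xs ] ⟦ x ≟A y ⟧ * f y) ≡ f y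
    collapse {y} y∈ys = begin
      (∑[ x ← xs ] ⟦ x ≟A y ⟧ * f y)    ≡⟨ ∑-*ʳ xs _ (f y) ⟩
      (∑[ x ← xs ] ⟦ x ≟A y ⟧) * f y    ≡⟨ cong (_* f y) (∑-δ-∈ !xs (ys⊆xs y∈ys)) ⟩
      1 * f y                           ≡⟨ *-identityˡ (f y) ⟩
      f y                               ∎
    replace : ∀ x y → ⟦ y ≟A x ⟧ * f x ≡ ⟦ x ≟A y ⟧ * f y
    replace x y with y ≟A x | x ≟A y
    ... | yes refl | yes _   = refl
    ... | yes refl | no x≢x  = contradiction refl x≢x
    ... | no x≢x   | yes refl = contradiction refl x≢x
    ... | no _     | no _    = refl
    δ-sum : ∀ x → f x ≡ (∑[ y ← ys ] ⟦ y ≟A x ⟧) * f x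
    δ-sum x with any? (x ≟A_) ys
    ... | yes x∈ys = sym (trans (cong (_* f x) (∑-δ-∈ !ys x∈ys)) (*-identityˡ (f x)))
    ... | no x∉ys  = trans (f≡0 x x∉ys) (sym (cong (_* f x) (∑-δ-∉ x∉ys)))
    expand : ∀ x → f x ≡ (∑[ y ← ys ] ⟦ x ≟A y ⟧ * f y)
    expand x = trans (δ-sum x) (trans (sym (∑-*ʳ ys _ (f x))) (∑-cong ys (replace x)))

-- As at most one element satisfies `P`, the sum is 0 or 1, and the first summand is its complement.
∑-exclusive : ∀ {P : A → Set} (P? : Decidable P) {xs} (none? : Dec (¬ Any P xs)) →
              AllPairs (λ x y → P x → ¬ P y) xs →
              ⟦ none? ⟧ + (∑[ x ← xs ] ⟦ P? x ⟧) ≡ 1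
∑-exclusive P? {[]}     none? []            = cong (_+ 0) (⟦⟧-yes none? λ ())
∑-exclusive P? {x ∷ xs} none? (excl ∷ excls) with P? x
... | yes px = cong₂ _+_ (⟦⟧-no none? λ none → none (here px))
    (cong suc (trans (∑-cong-All (All.map (λ {y} e → ⟦⟧-no (P? y) (e px)) excl))
                     (∑-zero xs)))
... | no ¬px = trans (cong (_+ (∑[ y ← xs ] ⟦ P? y ⟧))
                        (⟦⟧-cong none? (¬? (any? P? xs))
                          (_∘ there)
                          (λ { ¬any (here px) → ¬px px ; ¬any (there any) → ¬any any })))
                     (∑-exclusive P? (¬? (any? P? xs)) excls)

-- Arrangements and subsets of a list of letters

selections : List A → List (A × List A)
selections []       = []
selections (x ∷ xs) = (x , xs) ∷ map (λ (y , ys) → y , x ∷ ys) (selections xs)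

-- The words of l letters taken from distinct places of the list, each with
-- the letters left over.
arrangements : ∀ l → List A → List (Vec A l × List A)
arrangements zero    xs = ([] , xs) ∷ []
arrangements (suc l) xs =
  concatMap (λ (x , ys) → map (λ (u , zs) → x ∷ u , zs) (arrangements l ys))
            (selections xs)

combinations : ℕ → List A → List (List A)
combinations zero    xs       = [] ∷ []
combinations (suc a) []       = []
combinations (suc a) (x ∷ xs) = map (x ∷_) (combinations a xs) ++ combinations (suc a) xs

∑-selections-∷ : ∀ (x : A) xs (f : A × List A → ℕ) →
  ∑ (selections (x ∷ xs)) f ≡ f (x , xs) + (∑[ (y , ys) ← selections xs ] f (y , x ∷ ys))
∑-selections-∷ x xs f = cong (f (x , xs) +_) (∑-map _ (selections xs) f)

∑-arrangements-suc : ∀ l xs (f : Vec A (suc l) × List A → ℕ) →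
  ∑ (arrangements (suc l) xs) f ≡
  (∑[ (x , ys) ← selections xs ] ∑[ (u , zs) ← arrangements l ys ] f (x ∷ u , zs))
∑-arrangements-suc l xs f =
  trans (∑-concatMap _ (selections xs) f)
        (∑-cong (selections xs) λ (x , ys) → ∑-map _ (arrangements l ys) f)

-- The leftover letters make the split possible: the second block draws on exactly what the first
-- one left.
∑-arrangements-+ : ∀ a {b} xs (f : Vec A (a + b) × List A → ℕ) →
  ∑ (arrangements (a + b) xs) f ≡
  (∑[ (u , ys) ← arrangements a xs ] ∑[ (v , zs) ← arrangements b ys ] f (u Vec.++ v , zs))
∑-arrangements-+ zero    xs f = sym (+-identityʳ _)
∑-arrangements-+ (suc a) xs f =
  trans (∑-arrangements-suc _ xs f)
  (trans (∑-cong (selections xs) λ (x , ys) → ∑-arrangements-+ a ys _)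
         (sym (∑-arrangements-suc a xs _)))

∑-combinations-suc : ∀ a (x : A) xs (f : List A → ℕ) →
  ∑ (combinations (suc a) (x ∷ xs)) f ≡
  (∑[ ys ← combinations a xs ] f (x ∷ ys)) + ∑ (combinations (suc a) xs) f
∑-combinations-suc a x xs f =
  trans (∑-++ (map (x ∷_) (combinations a xs)) _ f)
        (cong (_+ ∑ (combinations (suc a) xs) f) (∑-map (x ∷_) (combinations a xs) f))

-- Double counting of subsets of size `suc a` with a distinguished letter: on the left the letter is
-- chosen first and then the rest of the subset, on the right the subset comes first.
∑-selections-combinations : ∀ a xs (f : A → List A → ℕ) →
  (∑[ (x , ys) ← selections xs ] ∑[ zs ← combinations a ys ] f x zs) ≡
  (∑[ zs ← combinations (suc a) xs ] ∑[ (x , ys) ← selections zs ] f x ys)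
∑-selections-combinations a       []       f = refl
∑-selections-combinations zero    (x ∷ xs) f = begin
  (∑[ (y , ys) ← selections (x ∷ xs) ] ∑[ zs ← combinations 0 ys ] f y zs)
    ≡⟨ ∑-selections-∷ x xs (λ (y , ys) → ∑[ zs ← combinations 0 ys ] f y zs) ⟩
  (f x [] + 0) + (∑[ (y , ys) ← selections xs ] ∑[ zs ← combinations 0 ys ] f y zs)
    ≡⟨ cong₂ _+_ (sym (+-identityʳ _)) (∑-selections-combinations zero xs f) ⟩
  ((f x [] + 0) + 0) + (∑[ zs ← combinations 1 xs ] ∑[ (y , ys) ← selections zs ] f y ys)
    ≡⟨ ∑-combinations-suc 0 x xs (λ zs → ∑[ (y , ys) ← selections zs ] f y ys) ⟨
  (∑[ zs ← combinations 1 (x ∷ xs) ] ∑[ (y , ys) ← selections zs ] f y ys) ∎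
  where open ≡-Reasoning
∑-selections-combinations {A} (suc a) (x ∷ xs) f = begin
  ∑ (selections (x ∷ xs)) sel
    ≡⟨ ∑-selections-∷ x xs sel ⟩
  X + (∑[ (y , ys) ← selections xs ] ∑[ zs ← combinations (suc a) (x ∷ ys) ] f y zs)
    ≡⟨ cong (X +_) (∑-cong (selections xs) λ (y , ys) → ∑-combinations-suc a x ys (f y)) ⟩
  X + (∑[ (y , ys) ← selections xs ]
        ((∑[ zs ← combinations a ys ] f y (x ∷ zs)) + (∑[ zs ← combinations (suc a) ys ] f y zs)))
    ≡⟨ cong (X +_) (∑-+ (selections xs) _ _) ⟩
  X + ((∑[ (y , ys) ← selections xs ] ∑[ zs ← combinations a ys ] f y (x ∷ zs)) +
       (∑[ (y , ys) ← selections xs ] ∑[ zs ← combinations (suc a) ys ] f y zs))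
    ≡⟨ cong (X +_) (cong₂ _+_ (∑-selections-combinations a xs (λ y zs → f y (x ∷ zs)))
                              (∑-selections-combinations (suc a) xs f)) ⟩
  X + (Y + Z)
    ≡⟨ +-assoc X Y Z ⟨
  (X + Y) + Z
    ≡⟨ cong (_+ Z) (∑-+ (combinations (suc a) xs) (f x) _) ⟨
  (∑[ zs ← combinations (suc a) xs ]
     f x zs + (∑[ (y , ys) ← selections zs ] f y (x ∷ ys))) + Z
    ≡⟨ cong (_+ Z) (∑-cong (combinations (suc a) xs) λ zs →
         ∑-selections-∷ x zs (λ (y , ys) → f y ys)) ⟨
  (∑[ zs ← combinations (suc a) xs ] com (x ∷ zs)) + Z
    ≡⟨ ∑-combinations-suc (suc a) x xs com ⟨
  ∑ (combinations (suc (suc a)) (x ∷ xs)) com ∎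
  where
  open ≡-Reasoning
  sel : A × List A → ℕ
  sel (y , ys) = ∑[ zs ← combinations (suc a) ys ] f y zs
  com : List A → ℕ
  com zs = ∑[ (y , ys) ← selections zs ] f y ys
  -- `X`, `Y`, `Z` collect the cases where `x` is the distinguished letter, lies in the subset
  -- without being distinguished, and is absent.
  X = ∑[ zs ← combinations (suc a) xs ] f x zs
  Y = ∑[ zs ← combinations (suc a) xs ] ∑[ (y , ys) ← selections zs ] f y (x ∷ ys)
  Z = ∑[ zs ← combinations (suc (suc a)) xs ] com zs

-- Groups the arrangements by their set of letters. In the induction the first letter is chosen
-- before the set of the others, and `∑-selections-combinations` exchanges the two choices.
∑-arrangements-combinations : ∀ a xs (f : Vec A a → ℕ) →
  ∑ (arrangements a xs) (f ∘ proj₁) ≡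
  (∑[ ys ← combinations a xs ] ∑ (arrangements a ys) (f ∘ proj₁))
∑-arrangements-combinations zero    xs f = sym (+-identityʳ _)
∑-arrangements-combinations {A} (suc a) xs f = begin
  ∑ (arrangements (suc a) xs) (f ∘ proj₁)
    ≡⟨ ∑-arrangements-suc a xs (f ∘ proj₁) ⟩
  (∑[ (x , ys) ← selections xs ] ∑ (arrangements a ys) (f ∘ (x ∷_) ∘ proj₁))
    ≡⟨ ∑-cong (selections xs) (λ (x , ys) → ∑-arrangements-combinations a ys (f ∘ (x ∷_))) ⟩
  (∑[ (x , ys) ← selections xs ] ∑[ zs ← combinations a ys ] g x zs)
    ≡⟨ ∑-selections-combinations a xs g ⟩
  (∑[ zs ← combinations (suc a) xs ] ∑[ (x , ys) ← selections zs ] g x ys)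
    ≡⟨ ∑-cong (combinations (suc a) xs) (λ zs → ∑-arrangements-suc a zs (f ∘ proj₁)) ⟨
  (∑[ zs ← combinations (suc a) xs ] ∑ (arrangements (suc a) zs) (f ∘ proj₁)) ∎
  where
  open ≡-Reasoning
  g : A → List A → ℕ
  g x zs = ∑ (arrangements a zs) (f ∘ (x ∷_) ∘ proj₁)

nC0≡1 : ∀ n → n C 0 ≡ 1
nC0≡1 n = trans (nCk≡nC[n∸k] {0} {n} z≤n) (nCn≡1 n)

length-combinations : ∀ a (xs : List A) → length (combinations a xs) ≡ length xs C a
length-combinations zero    xs       = sym (nC0≡1 (length xs))
length-combinations (suc a) []       = refl
length-combinations (suc a) (x ∷ xs) = begin
  length (map (x ∷_) (combinations a xs) ++ combinations (suc a) xs)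
    ≡⟨ length-++ (map (x ∷_) (combinations a xs)) ⟩
  length (map (x ∷_) (combinations a xs)) + length (combinations (suc a) xs)
    ≡⟨ cong₂ _+_ (trans (length-map _ (combinations a xs)) (length-combinations a xs))
                 (length-combinations (suc a) xs) ⟩
  length xs C a + length xs C suc a
    ≡⟨ nCk+nC[k+1]≡[n+1]C[k+1] (length xs) a ⟩
  suc (length xs) C suc a ∎
  where open ≡-Reasoning

selections-↭ : ∀ (xs : List A) → All (λ (x , ys) → x ∷ ys ↭ xs) (selections xs)
selections-↭ []       = []
selections-↭ (x ∷ xs) =
  ↭-refl ∷ All.map⁺ (All.map (λ p → ↭-trans (swap _ _ ↭-refl) (prep x p)) (selections-↭ xs))

map-proj₁-selections : ∀ (xs : List A) → map proj₁ (selections xs) ≡ xs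
map-proj₁-selections []       = refl
map-proj₁-selections (x ∷ xs) =
  cong (x ∷_) (trans (sym (map-∘ (selections xs))) (map-proj₁-selections xs))

selections-AllPairs : ∀ {R : A → A → Set} {xs} → AllPairs R xs →
                      All (AllPairs R ∘ proj₂) (selections xs)
selections-AllPairs []       = []
selections-AllPairs {xs = x ∷ xs} (r ∷ rs) =
  rs ∷ All.map⁺ (All.zipWith (λ (p , rs′) → All.tail (↭.All-resp-↭ (↭-sym p) r) ∷ rs′)
                             (selections-↭ xs , selections-AllPairs rs))

-- Used with `Fin._<_`: the letters left over from a sorted alphabet are again sorted and their
-- number is known, so an order-invariant sum over their arrangements does not depend on which
-- letters were taken.
arrangements-leftover : ∀ {R : A → A → Set} l {b xs} → AllPairs R xs → length xs ≡ l + b →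
  All (λ (_ , ys) → AllPairs R ys × length ys ≡ b) (arrangements l xs)
arrangements-leftover zero    rs len = (rs , len) ∷ []
arrangements-leftover (suc l) {xs = xs} rs len =
  All.concat⁺ (All.map⁺ (All.zipWith
    (λ (p , rs′) → All.map⁺
      (arrangements-leftover l rs′ (suc-injective (trans (↭.↭-length p) len))))
    (selections-↭ xs , selections-AllPairs rs)))

combinations-All : ∀ {P : A → Set} a {xs} → All P xs → All (All P) (combinations a xs)
combinations-All zero    _        = [] ∷ []
combinations-All (suc a) []       = []
combinations-All (suc a) (p ∷ ps) =
  All.++⁺ (All.map⁺ (All.map (p ∷_) (combinations-All a ps))) (combinations-All (suc a) ps)

combinations-AllPairs : ∀ {R : A → A → Set} a {xs} → AllPairs R xs →
  All (λ ys → AllPairs R ys × length ys ≡ a) (combinations a xs)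
combinations-AllPairs zero    _        = ([] , refl) ∷ []
combinations-AllPairs (suc a) []       = []
combinations-AllPairs (suc a) (r ∷ rs) =
  All.++⁺ (All.map⁺ (All.zipWith (λ (r′ , rs′ , len) → r′ ∷ rs′ , cong suc len)
                                 (combinations-All a r , combinations-AllPairs a rs)))
          (combinations-AllPairs (suc a) rs)

-- Arrangements as words without repeated letters

module _ {n : ℕ} where
  open DecMembership (Fin._≟_ {n}) using (_∈?_)

  Arranges : ∀ {l} → List (Fin n) → Vec (Fin n) l → Set
  Arranges xs w = Vec.Unique w × VecAll.All (_∈ xs) w

  arranges? : ∀ {l} xs → Decidable (Arranges {l} xs)
  arranges? xs w = VecAllPairs.allPairs? (λ x y → ¬? (x Fin.≟ y)) w ×-dec
                   VecAll.all? (_∈? xs) w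

  -- Induction on the word: a first letter outside `xs` contributes 0, and after a letter `x` of
  -- `xs` the rest must arrange what `selections` leaves beside `x`.
  ∑-words : ∀ l {xs} → List.Unique xs → ∀ (f : Vec (Fin n) l → ℕ) →
            (∑[ w ← words n l ] ⟦ arranges? xs w ⟧ * f w) ≡ ∑ (arrangements l xs) (f ∘ proj₁)
  ∑-words zero    {xs} !xs f = cong (_+ 0) (*-identityˡ (f []))
  ∑-words (suc l) {xs} !xs f = begin
    (∑[ w ← words n (suc l) ] ⟦ arranges? xs w ⟧ * f w)
      ≡⟨ ∑-cartesianProductWith _∷_ (allFin n) (words n l) _ ⟩
    ∑ (allFin n) g
      ≡⟨ ∑-⊆ Fin._≟_ (Unique.allFin⁺ n) !xs (λ _ → ∈-allFin _) g g≡0 ⟩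
    ∑ xs g
      ≡⟨ cong (λ ys → ∑ ys g) (map-proj₁-selections xs) ⟨
    ∑ (map proj₁ (selections xs)) g
      ≡⟨ ∑-map proj₁ (selections xs) g ⟩
    (∑[ (x , _) ← selections xs ] ∑[ w ← words n l ] ⟦ arranges? xs (x ∷ w) ⟧ * f (x ∷ w))
      ≡⟨ ∑-cong-All (All.map step (selections-↭ xs)) ⟩
    (∑[ (x , ys) ← selections xs ] ∑ (arrangements l ys) (f ∘ (x ∷_) ∘ proj₁))
      ≡⟨ ∑-arrangements-suc l xs _ ⟨
    ∑ (arrangements (suc l) xs) (f ∘ proj₁) ∎
    where
    open ≡-Reasoning
    g : Fin n → ℕ
    g x = ∑[ w ← words n l ] ⟦ arranges? xs (x ∷ w) ⟧ * f (x ∷ w)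

    g≡0 : ∀ x → x ∉ xs → g x ≡ 0
    g≡0 x x∉xs = trans (∑-cong (words n l) λ w → cong (_* f (x ∷ w))
                         (⟦⟧-no (arranges? xs (x ∷ w)) λ { (_ , x∈xs VecAll.∷ _) → x∉xs x∈xs }))
                       (∑-zero (words n l))

    step : ∀ {(x , ys) : Fin n × List (Fin n)} → x ∷ ys ↭ xs →
           (∑[ w ← words n l ] ⟦ arranges? xs (x ∷ w) ⟧ * f (x ∷ w)) ≡
           ∑ (arrangements l ys) (f ∘ (x ∷_) ∘ proj₁)
    step {x , ys} p with ↭ₛ.Unique-resp-↭ (setoid _) (↭⇒↭ₛ (↭-sym p)) !xs
    ... | x∉ys ∷ !ys = trans
      (∑-cong (words n l) λ w → cong (_* f (x ∷ w))
        (⟦⟧-cong (arranges? xs (x ∷ w)) (arranges? ys w) tail cons))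
      (∑-words l !ys (f ∘ (x ∷_)))
      where
      tail : ∀ {w} → Arranges xs (x ∷ w) → Arranges ys w
      tail (x∉w VecAllPairs.∷ !w , _ VecAll.∷ w⊆xs) =
        !w , VecAll.map (λ (x≢y , y∈xs) → other x≢y (↭.∈-resp-↭ (↭-sym p) y∈xs))
                          (VecAll.zip (x∉w , w⊆xs))
        where
        other : ∀ {y} → x ≢ y → y ∈ x ∷ ys → y ∈ ys
        other x≢y (here refl)  = contradiction refl x≢y
        other x≢y (there y∈ys) = y∈ys
      cons : ∀ {w} → Arranges ys w → Arranges xs (x ∷ w)
      cons (!w , w⊆ys) =
        VecAll.map (λ y∈ys → All.lookup x∉ys y∈ys) w⊆ys VecAllPairs.∷ !w ,
        ↭.∈-resp-↭ p (here refl) VecAll.∷ VecAll.map (↭.∈-resp-↭ p ∘ there) w⊆ys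

∑-𝔖 : ∀ n (f : Vec (Fin n) n → ℕ) →
      ∑ (𝔖 n) f ≡ ∑ (arrangements n (allFin n)) (f ∘ proj₁)
∑-𝔖 n f = begin
  ∑ (𝔖 n) f
    ≡⟨ ∑-filter isPermutation? (words n n) f ⟩
  (∑[ w ← words n n ] ⟦ isPermutation? w ⟧ * f w)
    ≡⟨ ∑-cong (words n n) (λ w → cong (_* f w)
         (⟦⟧-cong (isPermutation? w) (arranges? (allFin n) w)
           (λ !w → !w , VecAll.universal ∈-allFin w) proj₁)) ⟩
  (∑[ w ← words n n ] ⟦ arranges? (allFin n) w ⟧ * f w)
    ≡⟨ ∑-words n (Unique.allFin⁺ n) f ⟩
  ∑ (arrangements n (allFin n)) (f ∘ proj₁) ∎
  where open ≡-Reasoning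

-- Order-invariant statistics

Increasing : ∀ {m n} → (Fin m → Fin n) → Set
Increasing h = ∀ {i j} → i Fin.< j → h i Fin.< h j

Sorted : ∀ {n} → List (Fin n) → Set
Sorted = AllPairs Fin._<_

-- Polymorphic in the alphabet, because the same statistic is evaluated on a block of a longer
-- permutation and on permutations of the block's own size.
Statistic : ℕ → Set
Statistic l = ∀ {n} → Vec (Fin n) l → ℕ

OrderInvariant : ∀ {l} → Statistic l → Set
OrderInvariant f = ∀ {m n} (h : Fin m → Fin n) → Increasing h → ∀ w → f (Vec.map h w) ≡ f w

-- By `∑-𝔖` this is the sum over `𝔖 n`; arrangements replace filtered words since they can be split
-- at a cut.
∑𝔖 : ∀ {n} → Statistic n → ℕ
∑𝔖 {n} f = ∑ (arrangements n (allFin n)) (f ∘ proj₁)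

selections-map : ∀ (h : A → B) xs →
  selections (map h xs) ≡ map (λ (x , ys) → h x , map h ys) (selections xs)
selections-map h []       = refl
selections-map h (x ∷ xs) = cong ((h x , map h xs) ∷_)
  (trans (cong (map _) (selections-map h xs))
         (trans (sym (map-∘ (selections xs))) (map-∘ (selections xs))))

∑-arrangements-map : ∀ l (h : A → B) xs f →
  ∑ (arrangements l (map h xs)) f ≡
  (∑[ (u , ys) ← arrangements l xs ] f (Vec.map h u , map h ys))
∑-arrangements-map zero    h xs f = refl
∑-arrangements-map (suc l) h xs f = begin
  ∑ (arrangements (suc l) (map h xs)) f
    ≡⟨ ∑-arrangements-suc l (map h xs) f ⟩
  ∑ (selections (map h xs)) g
    ≡⟨ cong (λ s → ∑ s g) (selections-map h xs) ⟩
  ∑ (map (λ (x , ys) → h x , map h ys) (selections xs)) g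
    ≡⟨ ∑-map _ (selections xs) g ⟩
  (∑[ (x , ys) ← selections xs ] ∑[ (u , zs) ← arrangements l (map h ys) ] f (h x ∷ u , zs))
    ≡⟨ ∑-cong (selections xs) (λ (x , ys) → ∑-arrangements-map l h ys _) ⟩
  (∑[ (x , ys) ← selections xs ] ∑[ (u , zs) ← arrangements l ys ]
     f (h x ∷ Vec.map h u , map h zs))
    ≡⟨ ∑-arrangements-suc l xs _ ⟨
  (∑[ (u , ys) ← arrangements (suc l) xs ] f (Vec.map h u , map h ys)) ∎
  where
  open ≡-Reasoning
  g = λ (x , ys) → ∑[ (u , zs) ← arrangements l ys ] f (x ∷ u , zs)

lookup-increasing : ∀ {n} {xs : List (Fin n)} → Sorted xs → Increasing (lookup xs)
lookup-increasing (r ∷ rs) {Fin.zero}  {Fin.suc j} _   = All.lookup r (∈-lookup j)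
lookup-increasing (r ∷ rs) {Fin.suc i} {Fin.suc j} i<j = lookup-increasing rs (s<s⁻¹ i<j)

-- `lookup xs` is the increasing bijection from `Fin b` onto the letters of `xs`, so the
-- arrangements of `xs` are relabelled arrangements of `allFin b`, and `f` takes the same values on
-- them.
∑-arrangements-sorted : ∀ {l} {f : Statistic l} → OrderInvariant f →
  ∀ {n b} {xs : List (Fin n)} → Sorted xs → length xs ≡ b →
  ∑ (arrangements l xs) (f ∘ proj₁) ≡ ∑ (arrangements l (allFin b)) (f ∘ proj₁)
∑-arrangements-sorted {l} {f} f-inv {xs = xs} sorted refl = begin
  ∑ (arrangements l xs) (f ∘ proj₁)
    ≡⟨ cong (λ ys → ∑ (arrangements l ys) (f ∘ proj₁)) xs≡ ⟩
  ∑ (arrangements l (map (lookup xs) (allFin (length xs)))) (f ∘ proj₁)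
    ≡⟨ ∑-arrangements-map l (lookup xs) (allFin (length xs)) (f ∘ proj₁) ⟩
  ∑ (arrangements l (allFin (length xs))) (f ∘ Vec.map (lookup xs) ∘ proj₁)
    ≡⟨ ∑-cong (arrangements l (allFin (length xs)))
         (λ (u , _) → f-inv (lookup xs) (lookup-increasing sorted) u) ⟩
  ∑ (arrangements l (allFin (length xs))) (f ∘ proj₁) ∎
  where
  open ≡-Reasoning
  xs≡ : xs ≡ map (lookup xs) (allFin (length xs))
  xs≡ = sym (trans (map-tabulate id (lookup xs)) (tabulate-lookup xs))

allFin-sorted : ∀ n → Sorted (allFin n)
allFin-sorted n = AllPairs.tabulate⁺-< id

∑-arrangements-allFin : ∀ {a} {f : Statistic a} → OrderInvariant f → ∀ n →
  ∑ (arrangements a (allFin n)) (f ∘ proj₁) ≡ (n C a) * ∑𝔖 f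
∑-arrangements-allFin {a} {f} f-inv n = begin
  ∑ (arrangements a (allFin n)) (f ∘ proj₁)
    ≡⟨ ∑-arrangements-combinations a (allFin n) f ⟩
  (∑[ xs ← combinations a (allFin n) ] ∑ (arrangements a xs) (f ∘ proj₁))
    ≡⟨ ∑-cong-All (All.map (λ (sorted , len) → ∑-arrangements-sorted f-inv sorted len)
                           (combinations-AllPairs a (allFin-sorted n))) ⟩
  (∑[ _ ← combinations a (allFin n) ] ∑𝔖 f)
    ≡⟨ ∑-const (combinations a (allFin n)) (∑𝔖 f) ⟩
  length (combinations a (allFin n)) * ∑𝔖 f
    ≡⟨ cong (_* ∑𝔖 f) (length-combinations a (allFin n)) ⟩
  (length (allFin n) C a) * ∑𝔖 f
    ≡⟨ cong (λ m → (m C a) * ∑𝔖 f) (length-tabulate {n = n} id) ⟩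
  (n C a) * ∑𝔖 f ∎
  where open ≡-Reasoning

-- Whatever the first block is, the second one arranges a sorted list of `b` letters and contributes
-- `∑𝔖 g`. The binomial coefficient counts the letter sets of the first block, each contributing
-- `∑𝔖 f`.
∑𝔖-split : ∀ {a b} {f : Statistic a} {g : Statistic b} {h : Statistic (a + b)} →
  OrderInvariant f → OrderInvariant g →
  (∀ {n} (u : Vec (Fin n) a) v → h (u Vec.++ v) ≡ f u * g v) →
  ∑𝔖 h ≡ ((a + b) C a) * ∑𝔖 f * ∑𝔖 g
∑𝔖-split {a} {b} {f} {g} {h} f-inv g-inv h≡f*g = begin
  ∑ (arrangements (a + b) letters) (h ∘ proj₁)
    ≡⟨ ∑-arrangements-+ a letters (h ∘ proj₁) ⟩
  (∑[ (u , ys) ← arrangements a letters ] ∑[ (v , _) ← arrangements b ys ] h (u Vec.++ v))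
    ≡⟨ ∑-cong-All (All.map inner (arrangements-leftover a (allFin-sorted (a + b))
                                                        (length-tabulate {n = a + b} id))) ⟩
  (∑[ (u , _) ← arrangements a letters ] f u * ∑𝔖 g)
    ≡⟨ ∑-*ʳ (arrangements a letters) (f ∘ proj₁) (∑𝔖 g) ⟩
  ∑ (arrangements a letters) (f ∘ proj₁) * ∑𝔖 g
    ≡⟨ cong (_* ∑𝔖 g) (∑-arrangements-allFin f-inv (a + b)) ⟩
  ((a + b) C a) * ∑𝔖 f * ∑𝔖 g ∎
  where
  open ≡-Reasoning
  letters = allFin (a + b)
  inner : ∀ {(u , ys) : Vec (Fin (a + b)) a × List (Fin (a + b))} →
          Sorted ys × length ys ≡ b →
          (∑[ (v , _) ← arrangements b ys ] h (u Vec.++ v)) ≡ f u * ∑𝔖 g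
  inner {u , ys} (sorted , len) =
    trans (∑-cong (arrangements b ys) λ (v , _) → h≡f*g u v)
    (trans (∑-*ˡ (arrangements b ys) (f u) (g ∘ proj₁))
           (cong (f u *_) (∑-arrangements-sorted g-inv sorted len)))

-- Order isomorphism and factors of words

OI-sym : {a : Vector (Fin m) l} {b : Vector (Fin n) l} →
         OrderIsomorphic a b → OrderIsomorphic b a
OI-sym e i j = ⇔-sym (e i j)

OI-trans : {a : Vector (Fin m) l} {b : Vector (Fin n) l} {c : Vector (Fin p) l} →
           OrderIsomorphic a b → OrderIsomorphic b c → OrderIsomorphic a c
OI-trans e e′ i j = ⇔-trans (e i j) (e′ i j)

OI-pointwise : {a b : Vector (Fin m) l} → (∀ i → a i ≡ b i) → OrderIsomorphic a b
OI-pointwise eq i j = mk⇔ (subst₂ Fin._<_ (eq i) (eq j))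
                          (subst₂ Fin._<_ (sym (eq i)) (sym (eq j)))

OI-increasing : {h : Fin m → Fin n} → Increasing h → (a : Vector (Fin m) l) →
                OrderIsomorphic (h ∘ a) a
OI-increasing {h = h} h-inc a i j = mk⇔ reflect h-inc
  where
  reflect : h (a i) Fin.< h (a j) → a i Fin.< a j
  reflect lt with Fin.<-cmp (a i) (a j)
  ... | tri< ai<aj _ _ = ai<aj
  ... | tri≈ _ ai≡aj _ = contradiction (cong h ai≡aj) (Fin.<⇒≢ lt)
  ... | tri> _ _ aj<ai = contradiction (h-inc aj<ai) (Fin.<-asym lt)

-- Any index with the right numerical value may replace the one built by `inject≤`, so entries of
-- factors are compared by arithmetic on positions alone.
factor-lookup : ∀ {A : Set} s l (s+l≤n : s + l ≤ n) (xs : Vec A n) j {i} →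
                toℕ i ≡ s + toℕ j → factor s l s+l≤n xs j ≡ Vec.lookup xs i
factor-lookup s l s+l≤n xs j i≡s+j = cong (Vec.lookup xs) (Fin.toℕ-injective
  (trans (Fin.toℕ-inject≤ (s ↑ʳ j) s+l≤n) (trans (Fin.toℕ-↑ʳ s j) (sym i≡s+j))))

toℕ-position : ∀ s l (s+l≤n : s + l ≤ n) (j : Fin l) →
               toℕ (inject≤ (s ↑ʳ j) s+l≤n) ≡ s + toℕ j
toℕ-position s l s+l≤n j = trans (Fin.toℕ-inject≤ (s ↑ʳ j) s+l≤n) (Fin.toℕ-↑ʳ s j)

factor-++ˡ : ∀ {A : Set} s l (s+l≤m+n : s + l ≤ m + n) (s+l≤m : s + l ≤ m)
             (u : Vec A m) (v : Vec A n) j →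
             factor s l s+l≤m+n (u Vec.++ v) j ≡ factor s l s+l≤m u j
factor-++ˡ {m = m} s l s+l≤m+n s+l≤m u v j = trans
  (Vec.lookup-++-< u v i i<m)
  (sym (factor-lookup s l s+l≤m u j (trans (Fin.toℕ-fromℕ< i<m) i≡s+j)))
  where
  i = inject≤ (s ↑ʳ j) s+l≤m+n
  i≡s+j : toℕ i ≡ s + toℕ j
  i≡s+j = toℕ-position s l s+l≤m+n j
  i<m : toℕ i < m
  i<m = subst (_< m) (sym i≡s+j) (<-≤-trans (+-monoʳ-< s (Fin.toℕ<n j)) s+l≤m)

factor-++ʳ : ∀ {A : Set} s l (m+s+l≤m+n : (m + s) + l ≤ m + n) (s+l≤n : s + l ≤ n)
             (u : Vec A m) (v : Vec A n) j →
             factor (m + s) l m+s+l≤m+n (u Vec.++ v) j ≡ factor s l s+l≤n v j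
factor-++ʳ {m = m} s l m+s+l≤m+n s+l≤n u v j = trans
  (factor-lookup (m + s) l m+s+l≤m+n (u Vec.++ v) j
    (trans (Fin.toℕ-↑ʳ m i)
           (trans (cong (m +_) (toℕ-position s l s+l≤n j)) (sym (+-assoc m s (toℕ j))))))
  (Vec.lookup-++ʳ u v i)
  where i = inject≤ (s ↑ʳ j) s+l≤n

-- Occurrences of patterns in words and in concatenations

module _ {k : ℕ} (Π : List (Vec (Fin k) k)) where

  open DecMembership _≟_ using (_∈?_)

  -- Unlike in ContainsSomeAt, positions start at 0 and the letters of the word
  -- may come from a larger alphabet.
  record Occurs (w : Vec (Fin n) l) (s : ℕ) : Set where
    constructor occurs
    field
      some : Any (λ σ → Σ[ s+k≤l ∈ s + k ≤ l ] OrderIsomorphic (factor s k s+k≤l w) (Vec.lookup σ)) Π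

  occurs-bound : ∀ {w : Vec (Fin n) l} {s} → Occurs w s → s + k ≤ l
  occurs-bound (occurs o) = proj₁ (proj₂ (Any.satisfied o))

  occurs? : (w : Vec (Fin n) l) → Decidable (Occurs w)
  occurs? {l = l} w s = map′ occurs Occurs.some (any? dec Π)
    where
    dec : ∀ σ → Dec (Σ[ s+k≤l ∈ s + k ≤ l ] OrderIsomorphic (factor s k s+k≤l w) (Vec.lookup σ))
    dec σ with s + k ≤? l
    ... | yes s+k≤l = map′ (s+k≤l ,_)
                           (λ (q , e) → subst (λ r → OrderIsomorphic (factor s k r w) (Vec.lookup σ))
                                              (≤-irrelevant q s+k≤l) e)
                           (orderIsomorphic? (factor s k s+k≤l w) (Vec.lookup σ))
    ... | no  s+k≰l = no (s+k≰l ∘ proj₁)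

  -- An occurrence depends only on the order type of its factor; relabelling letters and passing
  -- between a concatenation and its blocks are all instances.
  occurs-transport : ∀ {w : Vec (Fin n) l} {w′ : Vec (Fin p) m} {s s′} → s′ + k ≤ m →
    (∀ q q′ → OrderIsomorphic (factor s′ k q′ w′) (factor s k q w)) →
    Occurs w s → Occurs w′ s′
  occurs-transport s′+k≤m e (occurs o) =
    occurs (Any.map (λ (q , e′) → s′+k≤m , OI-trans (e q s′+k≤m) e′) o)

  HasPositions : List ℕ → Vec (Fin n) l → Set
  HasPositions I w = ∀ s → Occurs w s ⇔ s ∈ I

  hasPositions? : ∀ I → Decidable (HasPositions {n} {l} I)
  hasPositions? {l = l} I w =
    -- An occurrence has `s + k ≤ l`, of which only `s ≤ l` is used; hence the search below `suc l`.
    map′ (λ (f , g) s → mk⇔ (λ o → f (s≤s (m+n≤o⇒m≤o s (occurs-bound o))) o) (All.lookup g))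
         (λ h → (λ {s} _ → to (h s)) , All.tabulate (λ {s} → from (h s)))
      (allUpTo? (λ s → occurs? w s →-dec s ∈? I) (suc l) ×-dec All.all? (occurs? w) I)

  #positions : List ℕ → ℕ → ℕ
  #positions I n = ∑𝔖 {n} (λ w → ⟦ hasPositions? I w ⟧)

  occurs-map : ∀ {h : Fin m → Fin n} → Increasing h → (w : Vec (Fin m) l) → ∀ s →
               Occurs (Vec.map h w) s ⇔ Occurs w s
  occurs-map {h = h} h-inc w s = mk⇔
    (λ o → occurs-transport (occurs-bound o) (λ q q′ → OI-sym (iso q q′)) o)
    (λ o → occurs-transport (occurs-bound o) iso o)
    where
    iso : ∀ q q′ → OrderIsomorphic (factor s k q′ (Vec.map h w)) (factor s k q w)
    iso q q′ = OI-trans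
      (OI-pointwise λ j → trans (Vec.lookup-map _ h w)
        (cong h (factor-lookup s k q′ w j (toℕ-position s k q j))))
      (OI-increasing h-inc (factor s k q w))

  hasPositions-invariant : ∀ I → OrderInvariant {l} (λ w → ⟦ hasPositions? I w ⟧)
  hasPositions-invariant I h h-inc w =
    ⟦⟧-cong (hasPositions? I (Vec.map h w)) (hasPositions? I w)
      (λ H s → ⇔-trans (⇔-sym (occurs-map h-inc w s)) (H s))
      (λ H s → ⇔-trans (occurs-map h-inc w s) (H s))

  #positions-cong : ∀ {I J} → (∀ s → s ∈ I ⇔ s ∈ J) → ∀ n → #positions I n ≡ #positions J n
  #positions-cong {I} {J} I⇔J n = ∑-cong (arrangements n _) λ (w , _) →
    ⟦⟧-cong (hasPositions? I w) (hasPositions? J w)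
      (λ H s → ⇔-trans (H s) (I⇔J s)) (λ H s → ⇔-trans (H s) (⇔-sym (I⇔J s)))

  -- `pred` turns indices, which start at 1, into positions, which start at 0. It is injective on
  -- positive indices, whereas an index 0 would be confused with 1.
  #⟨⨾⟩≡#positions : ∀ {I} → All (1 ≤_) I → ∀ n → # Π ⟨ I ⨾ n ⟩ ≡ #positions (map pred I) n
  #⟨⨾⟩≡#positions {I} I≥1 n = begin
    # Π ⟨ I ⨾ n ⟩                        ≡⟨ length-filter (hasIndexSet? Π I) (𝔖 n) ⟩
    (∑[ w ← 𝔖 n ] ⟦ hasIndexSet? Π I w ⟧)
      ≡⟨ ∑-cong (𝔖 n) (λ w → ⟦⟧-cong (hasIndexSet? Π I w) (hasPositions? (map pred I) w)
           (λ H s → ⇔-trans (boxed s) (⇔-trans (H (suc s)) (shift s))) (unshift {w})) ⟩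
    (∑[ w ← 𝔖 n ] ⟦ hasPositions? (map pred I) w ⟧)  ≡⟨ ∑-𝔖 n _ ⟩
    #positions (map pred I) n           ∎
    where
    open ≡-Reasoning
    boxed : ∀ {w : Vec (Fin n) n} s → Occurs w s ⇔ ContainsSomeAt Π w (suc s)
    boxed s = mk⇔ Occurs.some occurs
    shift : ∀ s → suc s ∈ I ⇔ s ∈ map pred I
    shift s = mk⇔ (∈-map⁺ pred) back
      where
      back : s ∈ map pred I → suc s ∈ I
      back s∈ with ∈-map⁻ pred s∈
      ... | zero  , 0∈I , _    = contradiction (All.lookup I≥1 0∈I) λ ()
      ... | suc _ , i∈I , refl = i∈I
    unshift : ∀ {w : Vec (Fin n) n} → HasPositions (map pred I) w → HasIndexSet Π I w
    unshift H zero    = mk⇔ (λ c → contradiction (proj₂ (Any.satisfied c)) λ ())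
                            (λ 0∈I → contradiction (All.lookup I≥1 0∈I) λ ())
    unshift H (suc s) = ⇔-trans (⇔-sym (boxed s)) (⇔-trans (H s) (⇔-sym (shift s)))

  -- The positions of the occurrences in u ++ v that lie neither in u, of
  -- length m, nor in v.
  Straddles : ℕ → ℕ → Set
  Straddles m s = s < m × m < s + k

  module _ (u : Vec (Fin p) m) (v : Vec (Fin p) n) where

    occurs-++ˡ : ∀ {s} → s + k ≤ m → Occurs (u Vec.++ v) s ⇔ Occurs u s
    occurs-++ˡ {s} s+k≤m = mk⇔
      (occurs-transport s+k≤m
        λ q q′ → OI-pointwise λ j → sym (factor-++ˡ s k q q′ u v j))
      (occurs-transport (≤-trans s+k≤m (m≤m+n m n))
        λ q q′ → OI-pointwise λ j → factor-++ˡ s k q′ q u v j)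

    occurs-++ʳ : ∀ {s} → Occurs (u Vec.++ v) (m + s) ⇔ Occurs v s
    occurs-++ʳ {s} = mk⇔
      (λ o → occurs-transport
        (+-cancelˡ-≤ m _ _ (subst (_≤ m + n) (+-assoc m s k) (occurs-bound o)))
        (λ q q′ → OI-pointwise λ j → sym (factor-++ʳ s k q q′ u v j)) o)
      (λ o → occurs-transport
        (subst (_≤ m + n) (sym (+-assoc m s k)) (+-monoʳ-≤ m (occurs-bound o)))
        (λ q q′ → OI-pointwise λ j → factor-++ʳ s k q′ q u v j) o)

    -- A position in `u ++ v` lies inside `u`, straddles the cut, or lies inside `v`. `J` prescribes
    -- the first class, `K` the second, and the third is to be empty. The conditions on `K` and `J`,
    -- with `1 ≤ k`, keep the classes apart.
    hasPositions-++ : 1 ≤ k → ∀ {K J} → All (Straddles m) K → All (λ s → s + k ≤ m) J →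
      HasPositions (K ++ J) (u Vec.++ v) ⇔
      ((HasPositions J u × HasPositions [] v) ×
       (∀ s → Straddles m s → Occurs (u Vec.++ v) s ⇔ s ∈ K))
    hasPositions-++ 1≤k {K} {J} K-straddles J-low = mk⇔
      (λ H → ((λ s → mk⇔ (u⇒J H s) (J⇒u H s)) ,
              (λ s → mk⇔ (λ o → contradiction (to (H (m + s)) (from occurs-++ʳ o)) high∉) λ ())) ,
             (λ s str → mk⇔ (λ o → ∈K (to (H s) o) str) (from (H s) ∘ ∈-++⁺ˡ)))
      glue
      where
      ∈J : ∀ {s} → s ∈ K ++ J → s + k ≤ m → s ∈ J
      ∈J s∈ s+k≤m with ∈-++⁻ K s∈
      ... | inj₁ s∈K = contradiction s+k≤m (<⇒≱ (proj₂ (All.lookup K-straddles s∈K)))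
      ... | inj₂ s∈J = s∈J
      ∈K : ∀ {s} → s ∈ K ++ J → Straddles m s → s ∈ K
      ∈K s∈ (_ , m<s+k) with ∈-++⁻ K s∈
      ... | inj₁ s∈K = s∈K
      ... | inj₂ s∈J = contradiction (All.lookup J-low s∈J) (<⇒≱ m<s+k)
      high∉ : ∀ {s} → ¬ (m + s ∈ K ++ J)
      high∉ {s} s∈ with ∈-++⁻ K s∈
      ... | inj₁ s∈K = contradiction (m≤m+n m s) (<⇒≱ (proj₁ (All.lookup K-straddles s∈K)))
      ... | inj₂ s∈J = contradiction (All.lookup J-low s∈J)
                         (<⇒≱ (≤-<-trans (m≤m+n m s) (m<m+n (m + s) 1≤k)))
      u⇒J : HasPositions (K ++ J) (u Vec.++ v) → ∀ s → Occurs u s → s ∈ J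
      u⇒J H s o = ∈J (to (H s) (from (occurs-++ˡ (occurs-bound o)) o)) (occurs-bound o)
      J⇒u : HasPositions (K ++ J) (u Vec.++ v) → ∀ s → s ∈ J → Occurs u s
      J⇒u H s s∈J = to (occurs-++ˡ (All.lookup J-low s∈J)) (from (H s) (∈-++⁺ʳ K s∈J))
      glue : ((HasPositions J u × HasPositions [] v) ×
              (∀ s → Straddles m s → Occurs (u Vec.++ v) s ⇔ s ∈ K)) →
             HasPositions (K ++ J) (u Vec.++ v)
      glue ((Hu , Hv) , Hs) s with s + k ≤? m | s <? m
      ... | yes s+k≤m | _ = mk⇔ (∈-++⁺ʳ K ∘ to (Hu s) ∘ to (occurs-++ˡ s+k≤m))
                                (λ s∈ → from (occurs-++ˡ s+k≤m) (from (Hu s) (∈J s∈ s+k≤m)))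
      ... | no s+k≰m | yes s<m = mk⇔ (∈-++⁺ˡ ∘ to (Hs s str)) (λ s∈ → from (Hs s str) (∈K s∈ str))
        where str = s<m , ≰⇒> s+k≰m
      ... | no s+k≰m | no s≮m with ≮⇒≥ s≮m
      ...   | m≤s rewrite sym (m+[n∸m]≡n m≤s) =
        mk⇔ (λ o → contradiction (to (Hv (s ∸ m)) (to occurs-++ʳ o)) λ ())
            (λ s∈ → contradiction s∈ high∉)

  -- Nonoverlapping patterns and the counting identity at a cut

  module _ (nonoverlapping : Nonoverlapping Π) where

    -- The overlap has length `k ∸ (t ∸ s)`, which is at least 2 by `suc t < s + k` and less than
    -- `k` by `s < t`. It is the start of the later occurrence and the end of the earlier one, so a
    -- prefix of one pattern and a suffix of the other are order isomorphic to the same factor of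
    -- `w`.
    occurs-disjoint : ∀ {w : Vec (Fin n) l} {s t} → Occurs w s → Occurs w t →
                      s < t → suc t < s + k → ∀ {A : Set} → A
    occurs-disjoint {w = w} {s} {t} (occurs os) (occurs ot) s<t t+1<s+k
      with find os | find ot
    ... | σ , σ∈Π , (s+k≤n , eσ) | τ , τ∈Π , (t+k≤n , eτ) =
      contradiction clash (nonoverlapping τ∈Π σ∈Π o 1<o o<k)
      where
      d = t ∸ s
      o = k ∸ d
      t≡s+d : t ≡ s + d
      t≡s+d = sym (m+[n∸m]≡n (<⇒≤ s<t))
      d+1<k : suc d < k
      d+1<k = +-cancelˡ-< s _ _ (subst (_< s + k) (trans (cong suc t≡s+d) (sym (+-suc s d))) t+1<s+k)
      d<k : d < k
      d<k = <-trans (n<1+n d) d+1<k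
      1<o : 1 < o
      1<o = m+n≤o⇒m≤o∸n 2 d+1<k
      o<k : o < k
      o<k = ∸-monoʳ-< {k} {d} {0} (m<n⇒0<n∸m s<t) (<⇒≤ d<k)
      clash : OrderIsomorphic (prefix o (<⇒≤ o<k) τ) (suffix o (<⇒≤ o<k) σ)
      clash = OI-trans {b = factor t k t+k≤n w ∘ α} (λ i j → ⇔-sym (eτ (α i) (α j)))
               (OI-trans {b = factor s k s+k≤n w ∘ β} (OI-pointwise same)
                         (λ i j → eσ (β i) (β j)))
        where
        α β : Fin o → Fin k
        α j = inject≤ (0 ↑ʳ j) (<⇒≤ o<k)
        β j = inject≤ ((k ∸ o) ↑ʳ j) (≤-reflexive (m∸n+n≡m (<⇒≤ o<k)))
        -- Both sides read entry `t + j` of `w`: the suffix starts at offset `k ∸ o`, which is `d`,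
        -- that is, `t ∸ s`.
        same : ∀ j → factor t k t+k≤n w (α j) ≡ factor s k s+k≤n w (β j)
        same j = factor-lookup t k t+k≤n w (α j) (begin
          toℕ (inject≤ (s ↑ʳ β j) s+k≤n)  ≡⟨ toℕ-position s k s+k≤n (β j) ⟩
          s + toℕ (β j)                   ≡⟨ cong (s +_)
            (toℕ-position (k ∸ o) o (≤-reflexive (m∸n+n≡m (<⇒≤ o<k))) j) ⟩
          s + (k ∸ o + toℕ j)             ≡⟨ cong (λ e → s + (e + toℕ j)) (m∸[m∸n]≡n (<⇒≤ d<k)) ⟩
          s + (d + toℕ j)                 ≡⟨ +-assoc s d (toℕ j) ⟨
          s + d + toℕ j                   ≡⟨ cong₂ _+_ t≡s+d (toℕ-position 0 o (<⇒≤ o<k) j) ⟨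
          t + toℕ (α j)                   ∎)
          where open ≡-Reasoning

    -- Every straddling occurrence contains the entries on both sides of the cut, so two distinct
    -- ones would overlap in at least two entries.
    straddles-unique : ∀ {w : Vec (Fin n) l} {s t} → Straddles m s → Straddles m t →
                       Occurs w s → Occurs w t → s ≡ t
    straddles-unique {s = s} {t} (s<m , m<s+k) (t<m , m<t+k) os ot with <-cmp s t
    ... | tri< s<t _ _ = occurs-disjoint os ot s<t (≤-<-trans t<m m<s+k)
    ... | tri≈ _ s≡t _ = s≡t
    ... | tri> _ _ t<s = occurs-disjoint ot os t<s (≤-<-trans s<m m<t+k)

    #positions-overlap : ∀ {I s t} → s ∈ I → t ∈ I → s < t → suc t < s + k →
                         ∀ n → #positions I n ≡ 0
    #positions-overlap {I} {s} {t} s∈I t∈I s<t t+1<s+k n = trans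
      (∑-cong (arrangements n _) λ (w , _) → ⟦⟧-no (hasPositions? I w) λ H →
        occurs-disjoint (from (H s) s∈I) (from (H t) t∈I) s<t t+1<s+k)
      (∑-zero (arrangements n _))

    #positions-split : ∀ m n {S J} → 1 ≤ k →
      List.Unique S → (∀ s → s ∈ S ⇔ Straddles m s) → All (λ s → s + k ≤ m) J →
      #positions J (m + n) + (∑[ s ← S ] #positions (s ∷ J) (m + n)) ≡
      ((m + n) C m) * #positions J m * #positions [] n
    #positions-split m n {S} {J} 1≤k !S S⇔ J-low = begin
      #positions J (m + n) + (∑[ s ← S ] #positions (s ∷ J) (m + n))
        ≡⟨ cong (#positions J (m + n) +_) (∑-swap S (arrangements (m + n) _) _) ⟩
      #positions J (m + n) + ∑𝔖 {m + n} (λ w → ∑[ s ← S ] ⟦ hasPositions? (s ∷ J) w ⟧)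
        ≡⟨ ∑-+ (arrangements (m + n) _) _ _ ⟨
      ∑𝔖 {m + n} (λ w → ⟦ hasPositions? J w ⟧ + (∑[ s ← S ] ⟦ hasPositions? (s ∷ J) w ⟧))
        ≡⟨ ∑𝔖-split {h = λ w → ⟦ hasPositions? J w ⟧ + (∑[ s ← S ] ⟦ hasPositions? (s ∷ J) w ⟧)}
             (hasPositions-invariant J) (hasPositions-invariant []) separate ⟩
      ((m + n) C m) * #positions J m * #positions [] n ∎
      where
      open ≡-Reasoning
      -- With `T?` deciding the conditions on the two blocks, every term on the left is `⟦ T? ⟧`
      -- times the indicator of one alternative: no straddling occurrence, or one at `s`. Exactly
      -- one alternative holds, so the indicators add up to 1.
      separate : ∀ {p} (u : Vec (Fin p) m) (v : Vec (Fin p) n) →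
        ⟦ hasPositions? J (u Vec.++ v) ⟧ + (∑[ s ← S ] ⟦ hasPositions? (s ∷ J) (u Vec.++ v) ⟧) ≡
        ⟦ hasPositions? J u ⟧ * ⟦ hasPositions? [] v ⟧
      separate u v = begin
        ⟦ hasPositions? J w ⟧ + (∑[ s ← S ] ⟦ hasPositions? (s ∷ J) w ⟧)
          ≡⟨ cong₂ _+_ empty (∑-cong-All (All.tabulate single)) ⟩
        ⟦ T? ⟧ * ⟦ none? ⟧ + (∑[ s ← S ] ⟦ T? ⟧ * ⟦ occurs? w s ⟧)
          ≡⟨ cong (⟦ T? ⟧ * ⟦ none? ⟧ +_) (∑-*ˡ S ⟦ T? ⟧ _) ⟩
        ⟦ T? ⟧ * ⟦ none? ⟧ + ⟦ T? ⟧ * (∑[ s ← S ] ⟦ occurs? w s ⟧)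
          ≡⟨ *-distribˡ-+ ⟦ T? ⟧ ⟦ none? ⟧ _ ⟨
        ⟦ T? ⟧ * (⟦ none? ⟧ + (∑[ s ← S ] ⟦ occurs? w s ⟧))
          ≡⟨ cong (⟦ T? ⟧ *_) (∑-exclusive (occurs? w) none? (exclusive S-straddles !S)) ⟩
        ⟦ T? ⟧ * 1
          ≡⟨ *-identityʳ ⟦ T? ⟧ ⟩
        ⟦ T? ⟧
          ≡⟨ ⟦⟧-* T? (hasPositions? J u) (hasPositions? [] v) id id ⟩
        ⟦ hasPositions? J u ⟧ * ⟦ hasPositions? [] v ⟧ ∎
        where
        w = u Vec.++ v
        T? = hasPositions? J u ×-dec hasPositions? [] v
        none? = ¬? (any? (occurs? w) S)
        S-straddles : All (Straddles m) S
        S-straddles = All.tabulate (to (S⇔ _))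
        exclusive : ∀ {R} → All (Straddles m) R → List.Unique R →
                    AllPairs (λ s t → Occurs w s → ¬ Occurs w t) R
        exclusive []       []         = []
        exclusive (x ∷ xs) (x∉ ∷ !xs) =
          All.zipWith (λ (x≢y , y) ox oy → x≢y (straddles-unique x y ox oy)) (x∉ , xs) ∷
          exclusive xs !xs
        empty : ⟦ hasPositions? J w ⟧ ≡ ⟦ T? ⟧ * ⟦ none? ⟧
        empty = ⟦⟧-* (hasPositions? J w) T? none?
          (λ H → let (T , no-str) = to split H in
            T , λ any → let (s , s∈S , o) = find any in
              contradiction (to (no-str s (to (S⇔ s) s∈S)) o) λ ())
          (λ (T , none) → from split (T , λ s str →
            mk⇔ (λ o → contradiction (lose (from (S⇔ s) str) o) none) λ ()))
          where split = hasPositions-++ u v 1≤k [] J-low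
        -- An occurrence at `s` rules out all other straddling ones, so it alone determines the
        -- straddling part of the position set.
        single : ∀ {s} → s ∈ S → ⟦ hasPositions? (s ∷ J) w ⟧ ≡ ⟦ T? ⟧ * ⟦ occurs? w s ⟧
        single {s} s∈S = ⟦⟧-* (hasPositions? (s ∷ J) w) T? (occurs? w s)
          (λ H → proj₁ (to split H) , from (H s) (here refl))
          (λ (T , o) → from split (T , λ t str-t →
            mk⇔ (λ o′ → here (straddles-unique str-t str o′ o)) λ { (here refl) → o }))
          where
          str = to (S⇔ s) s∈S
          split = hasPositions-++ u v 1≤k (str ∷ []) J-low

-- The span V

-- Opened only here, as +_ would clash with the sections of addition above.
open import Data.Integer.Base as ℤ using (ℤ; +_)
import Data.Integer.Properties as ℤ
open import Data.Rational.Base as ℚ using (ℚ; 0ℚ; 1ℚ; _/_)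
import Data.Rational.Properties as ℚ
open import Data.Rational.Solver using (module +-*-Solver)
import Data.Rational.Unnormalised.Base as ℚᵘ
import Data.Rational.Unnormalised.Properties as ℚᵘ

-- `_/_` reduces fractions by a gcd, so the identity is checked on unnormalised rationals, where the
-- denominators 1 compute.
/1-+ : ∀ i j → (i ℤ.+ j) / 1 ≡ i / 1 ℚ.+ j / 1
/1-+ i j = ℚ.toℚᵘ-injective (begin
  ℚ.toℚᵘ ((i ℤ.+ j) / 1)                     ≈⟨ ℚ.toℚᵘ-fromℚᵘ (ℚᵘ.mkℚᵘ (i ℤ.+ j) 0) ⟩
  ℚᵘ.mkℚᵘ (i ℤ.+ j) 0                        ≡⟨ cong₂ (λ x y → ℚᵘ.mkℚᵘ (x ℤ.+ y) 0)
                                                      (ℤ.*-identityʳ i) (ℤ.*-identityʳ j) ⟨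
  ℚᵘ.mkℚᵘ i 0 ℚᵘ.+ ℚᵘ.mkℚᵘ j 0               ≈⟨ ℚᵘ.+-cong (ℚ.toℚᵘ-fromℚᵘ (ℚᵘ.mkℚᵘ i 0))
                                                          (ℚ.toℚᵘ-fromℚᵘ (ℚᵘ.mkℚᵘ j 0)) ⟨
  ℚ.toℚᵘ (i / 1) ℚᵘ.+ ℚ.toℚᵘ (j / 1)         ≈⟨ ℚ.toℚᵘ-homo-+ (i / 1) (j / 1) ⟨
  ℚ.toℚᵘ (i / 1 ℚ.+ j / 1)                   ∎)
  where open ℚᵘ.≃-Reasoning

/1-* : ∀ i j → (i ℤ.* j) / 1 ≡ (i / 1) ℚ.* (j / 1)
/1-* i j = ℚ.toℚᵘ-injective (begin
  ℚ.toℚᵘ ((i ℤ.* j) / 1)                     ≈⟨ ℚ.toℚᵘ-fromℚᵘ (ℚᵘ.mkℚᵘ (i ℤ.* j) 0) ⟩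
  ℚᵘ.mkℚᵘ i 0 ℚᵘ.* ℚᵘ.mkℚᵘ j 0               ≈⟨ ℚᵘ.*-cong (ℚ.toℚᵘ-fromℚᵘ (ℚᵘ.mkℚᵘ i 0))
                                                          (ℚ.toℚᵘ-fromℚᵘ (ℚᵘ.mkℚᵘ j 0)) ⟨
  ℚ.toℚᵘ (i / 1) ℚᵘ.* ℚ.toℚᵘ (j / 1)         ≈⟨ ℚ.toℚᵘ-homo-* (i / 1) (j / 1) ⟨
  ℚ.toℚᵘ ((i / 1) ℚ.* (j / 1))                   ∎)
  where open ℚᵘ.≃-Reasoning

fromℕ : ℕ → ℚ
fromℕ n = + n / 1

fromℕ-+ : ∀ m n → fromℕ (m + n) ≡ fromℕ m ℚ.+ fromℕ n
fromℕ-+ m n = /1-+ (+ m) (+ n)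

fromℕ-* : ∀ m n → fromℕ (m * n) ≡ fromℕ m ℚ.* fromℕ n
fromℕ-* m n = trans (cong (_/ 1) (ℤ.pos-* m n)) (/1-* (+ m) (+ n))

-- The absorption identity (k+1) C(n, k+1) = (n-k) C(n, k) with the subtraction moved to the other
-- side, so that it passes to ℚ by `fromℕ-+` and `fromℕ-*`. Pascal's rule reduces row n+1 to the
-- instances for k+1 and k in row n.
[k+1]*nC[k+1]+k*nCk≡n*nCk : ∀ n k → suc k * (n C suc k) + k * (n C k) ≡ n * (n C k)
[k+1]*nC[k+1]+k*nCk≡n*nCk zero    zero    = refl
[k+1]*nC[k+1]+k*nCk≡n*nCk zero    (suc k) = cong₂ _+_ (*-zeroʳ k) (*-zeroʳ k)
[k+1]*nC[k+1]+k*nCk≡n*nCk (suc n) zero    = begin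
  1 * (suc n C 1) + 0    ≡⟨ trans (+-identityʳ _) (*-identityˡ _) ⟩
  suc n C 1              ≡⟨ nC1≡n (suc n) ⟩
  suc n                  ≡⟨ *-identityʳ (suc n) ⟨
  suc n * 1              ≡⟨ cong (suc n *_) (nC0≡1 (suc n)) ⟨
  suc n * (suc n C 0)    ∎
  where open ≡-Reasoning
[k+1]*nC[k+1]+k*nCk≡n*nCk (suc n) (suc k) = begin
  (2 + k) * (suc n C (2 + k)) + (1 + k) * (suc n C (1 + k))
    ≡⟨ cong₂ (λ x y → (2 + k) * x + (1 + k) * y) (pascal (1 + k)) (pascal k) ⟨
  (2 + k) * (c₁ + c₂) + (1 + k) * (c₀ + c₁)
    ≡⟨ regroup k c₀ c₁ c₂ ⟩
  ((2 + k) * c₂ + (1 + k) * c₁) + (((1 + k) * c₁ + k * c₀) + (c₀ + c₁))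
    ≡⟨ cong₂ (λ x y → x + (y + (c₀ + c₁))) ([k+1]*nC[k+1]+k*nCk≡n*nCk n (suc k))
                                           ([k+1]*nC[k+1]+k*nCk≡n*nCk n k) ⟩
  n * c₁ + (n * c₀ + (c₀ + c₁))
    ≡⟨ collect n c₀ c₁ ⟩
  suc n * (c₀ + c₁)
    ≡⟨ cong (suc n *_) (pascal k) ⟩
  suc n * (suc n C suc k) ∎
  where
  open ≡-Reasoning
  c₀ = n C k
  c₁ = n C (1 + k)
  c₂ = n C (2 + k)
  pascal = nCk+nC[k+1]≡[n+1]C[k+1] n
  regroup : ∀ k c₀ c₁ c₂ → (2 + k) * (c₁ + c₂) + (1 + k) * (c₀ + c₁) ≡
            ((2 + k) * c₂ + (1 + k) * c₁) + (((1 + k) * c₁ + k * c₀) + (c₀ + c₁))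
  regroup = ℕ-Ring.solve-∀
  collect : ∀ n c₀ c₁ → n * c₁ + (n * c₀ + (c₀ + c₁)) ≡ suc n * (c₀ + c₁)
  collect = ℕ-Ring.solve-∀

linearCombination-++ : ∀ {X J : Set} (f : J → X → ℚ) ts us x →
  linearCombination f (ts ++ us) x ≡ linearCombination f ts x ℚ.+ linearCombination f us x
linearCombination-++ f []             us x = sym (ℚ.+-identityˡ _)
linearCombination-++ f ((c , j) ∷ ts) us x =
  trans (cong (c ℚ.* f j x ℚ.+_) (linearCombination-++ f ts us x))
        (sym (ℚ.+-assoc (c ℚ.* f j x) (linearCombination f ts x) _))

-- Serves both scaling, where `h` changes coefficients, and multiplication by n, where `h` raises
-- exponents.
linearCombination-* : ∀ {X J : Set} (f : J → X → ℚ) (φ : X → ℚ) (h : ℚ × J → ℚ × J) →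
  (∀ c j x → proj₁ (h (c , j)) ℚ.* f (proj₂ (h (c , j))) x ≡ φ x ℚ.* (c ℚ.* f j x)) →
  ∀ ts x → linearCombination f (map h ts) x ≡ φ x ℚ.* linearCombination f ts x
linearCombination-* f φ h eq []             x = sym (ℚ.*-zeroʳ (φ x))
linearCombination-* f φ h eq ((c , j) ∷ ts) x =
  trans (cong₂ ℚ._+_ (eq c j x) (linearCombination-* f φ h eq ts x))
        (sym (ℚ.*-distribˡ-+ (φ x) (c ℚ.* f j x) (linearCombination f ts x)))

module _ {k : ℕ} (Π : List (Vec (Fin k) k)) where

  V-0 : V Π (λ _ → 0ℚ)
  V-0 = [] , λ _ → refl

  V-+ : ∀ {g h} → V Π g → V Π h → V Π (λ n → g n ℚ.+ h n)
  V-+ (ts , g≡) (us , h≡) =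
    ts ++ us , λ n → trans (cong₂ ℚ._+_ (g≡ n) (h≡ n))
                           (sym (linearCombination-++ (generator Π) ts us n))

  V-scale : ∀ c {g} → V Π g → V Π (λ n → c ℚ.* g n)
  V-scale c (ts , g≡) = map (λ (d , j) → c ℚ.* d , j) ts , λ n →
    trans (cong (c ℚ.*_) (g≡ n))
          (sym (linearCombination-* (generator Π) (λ _ → c) _
                  (λ d j x → ℚ.*-assoc c d (generator Π j x)) ts n))

  V-n* : ∀ {g} → V Π g → V Π (λ n → n / 1 ℚ.* g n)
  V-n* (ts , g≡) = map (λ (c , j , l) → c , suc j , l) ts , λ n →
    trans (cong (n / 1 ℚ.*_) (g≡ n))
          (sym (linearCombination-* (generator Π) (_/ 1) _ raise ts n))
    where
    raise : ∀ c j n → c ℚ.* generator Π (suc (proj₁ j) , proj₂ j) n ≡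
                      n / 1 ℚ.* (c ℚ.* generator Π j n)
    raise c (j , l) n = begin
      c ℚ.* (((n ℤ.* n ℤ.^ j) ℤ.* a) / 1)
        ≡⟨ cong (λ i → c ℚ.* (i / 1)) (ℤ.*-assoc n (n ℤ.^ j) a) ⟩
      c ℚ.* ((n ℤ.* (n ℤ.^ j ℤ.* a)) / 1)             ≡⟨ cong (c ℚ.*_) (/1-* n (n ℤ.^ j ℤ.* a)) ⟩
      c ℚ.* (n / 1 ℚ.* r)                           ≡⟨ ℚ.*-assoc c (n / 1) r ⟨
      c ℚ.* (n / 1) ℚ.* r                             ≡⟨ cong (ℚ._* r) (ℚ.*-comm c (n / 1)) ⟩
      n / 1 ℚ.* c ℚ.* r                             ≡⟨ ℚ.*-assoc (n / 1) c r ⟩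
      n / 1 ℚ.* (c ℚ.* r)                           ∎
      where
      open ≡-Reasoning
      a = + av Π (n ℤ.+ l)
      r = (n ℤ.^ j ℤ.* a) / 1

  V-av : ∀ l → V Π (λ n → fromℕ (av Π (n ℤ.+ l)))
  V-av l = (1ℚ , 0 , l) ∷ [] , λ n → let a = + av Π (n ℤ.+ l) in sym
    (trans (ℚ.+-identityʳ (1ℚ ℚ.* ((ℤ.1ℤ ℤ.* a) / 1)))
    (trans (ℚ.*-identityˡ ((ℤ.1ℤ ℤ.* a) / 1)) (cong (_/ 1) (ℤ.*-identityˡ a))))

  -- C(n, a) is a polynomial in n, built up by C(n, a+1) = (n-a) C(n, a) / (a+1): multiplication by
  -- n and by constants preserves the span.
  V-C*av : ∀ a l → ∃ λ g → V Π g ×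
           ∀ n → g (+ n) ≡ fromℕ (n C a) ℚ.* fromℕ (av Π (+ n ℤ.+ l))
  V-C*av zero    l = _ , V-av l , λ n → let x = fromℕ (av Π (+ n ℤ.+ l)) in
    sym (trans (cong (λ c → fromℕ c ℚ.* x) (nC0≡1 n)) (ℚ.*-identityˡ x))
  V-C*av (suc a) l with V-C*av a l
  ... | g , Vg , g≡ =
    _ , V-scale q (V-+ (V-n* Vg) (V-scale (ℚ.- fromℕ a) Vg)) , λ n → absorb n
    where
    open ≡-Reasoning
    instance
      fromℕ-nonZero : ℚ.NonZero (fromℕ (suc a))
      fromℕ-nonZero = ℚ.pos⇒nonZero (fromℕ (suc a)) {{ℚ.normalize-pos (suc a) 1}}
    q = ℚ.1/ fromℕ (suc a)
    regroup : ∀ q s t c d x →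
              q ℚ.* ((s ℚ.* d ℚ.+ t ℚ.* c) ℚ.* x ℚ.+ (ℚ.- t) ℚ.* (c ℚ.* x)) ≡ (q ℚ.* s) ℚ.* (d ℚ.* x)
    regroup = solve 6 (λ q s t c d x →
      q :* ((s :* d :+ t :* c) :* x :+ (:- t) :* (c :* x)) := (q :* s) :* (d :* x)) refl
      where open +-*-Solver
    absorb : ∀ n → q ℚ.* (fromℕ n ℚ.* g (+ n) ℚ.+ (ℚ.- fromℕ a) ℚ.* g (+ n)) ≡
                   fromℕ (n C suc a) ℚ.* fromℕ (av Π (+ n ℤ.+ l))
    absorb n = begin
      q ℚ.* (fromℕ n ℚ.* g (+ n) ℚ.+ t ℚ.* g (+ n))
        ≡⟨ cong (λ y → q ℚ.* (fromℕ n ℚ.* y ℚ.+ t ℚ.* y)) (g≡ n) ⟩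
      q ℚ.* (fromℕ n ℚ.* (c ℚ.* x) ℚ.+ t ℚ.* (c ℚ.* x))
        ≡⟨ cong (λ y → q ℚ.* (y ℚ.+ t ℚ.* (c ℚ.* x)))
             (trans (sym (ℚ.*-assoc (fromℕ n) c x)) (cong (ℚ._* x) n*c≡)) ⟩
      q ℚ.* ((fromℕ (suc a) ℚ.* d ℚ.+ fromℕ a ℚ.* c) ℚ.* x ℚ.+ t ℚ.* (c ℚ.* x))
        ≡⟨ regroup q (fromℕ (suc a)) (fromℕ a) c d x ⟩
      (q ℚ.* fromℕ (suc a)) ℚ.* (d ℚ.* x)
        ≡⟨ cong (ℚ._* (d ℚ.* x)) (ℚ.*-inverseˡ (fromℕ (suc a))) ⟩
      1ℚ ℚ.* (d ℚ.* x)
        ≡⟨ ℚ.*-identityˡ (d ℚ.* x) ⟩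
      d ℚ.* x ∎
      where
      c = fromℕ (n C a)
      d = fromℕ (n C suc a)
      t = ℚ.- fromℕ a
      x = fromℕ (av Π (+ n ℤ.+ l))
      n*c≡ : fromℕ n ℚ.* c ≡ fromℕ (suc a) ℚ.* d ℚ.+ fromℕ a ℚ.* c
      n*c≡ = begin
        fromℕ n ℚ.* c                                     ≡⟨ fromℕ-* n (n C a) ⟨
        fromℕ (n * (n C a))                               ≡⟨ cong fromℕ ([k+1]*nC[k+1]+k*nCk≡n*nCk n a) ⟨
        fromℕ (suc a * (n C suc a) + a * (n C a))
          ≡⟨ fromℕ-+ (suc a * (n C suc a)) (a * (n C a)) ⟩
        fromℕ (suc a * (n C suc a)) ℚ.+ fromℕ (a * (n C a))
          ≡⟨ cong₂ ℚ._+_ (fromℕ-* (suc a) (n C suc a)) (fromℕ-* a (n C a)) ⟩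
        fromℕ (suc a) ℚ.* d ℚ.+ fromℕ a ℚ.* c             ∎

  -- Counts are functions on ℕ while the span consists of functions on ℤ; `m` is a threshold from
  -- which the two agree.
  record InV (m : ℕ) (f : ℕ → ℕ) : Set where
    constructor inV
    field
      {extension} : ℤ → ℚ
      member      : V Π extension
      agrees      : ∀ n → m ≤ n → fromℕ (f n) ≡ extension (+ n)

  InV-cong : ∀ {m f g} → (∀ n → m ≤ n → f n ≡ g n) → InV m f → InV m g
  InV-cong f≡g (inV Vh f≡h) =
    inV Vh λ n m≤n → trans (cong fromℕ (sym (f≡g n m≤n))) (f≡h n m≤n)

  InV-≤ : ∀ {m m′ f} → m ≤ m′ → InV m f → InV m′ f
  InV-≤ m≤m′ (inV Vh f≡h) = inV Vh λ n m′≤n → f≡h n (≤-trans m≤m′ m′≤n)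

  InV-0 : ∀ {m} → InV m (λ _ → 0)
  InV-0 = inV V-0 λ _ _ → refl

  InV-+ : ∀ {m f g} → InV m f → InV m g → InV m (λ n → f n + g n)
  InV-+ {f = f} {g} (inV Vf′ f≡) (inV Vg′ g≡) =
    inV (V-+ Vf′ Vg′) λ n m≤n → trans (fromℕ-+ (f n) (g n)) (cong₂ ℚ._+_ (f≡ n m≤n) (g≡ n m≤n))

  InV-scale : ∀ {m f} c → InV m f → InV m (λ n → c * f n)
  InV-scale {f = f} c (inV Vf′ f≡) =
    inV (V-scale (fromℕ c) Vf′) λ n m≤n →
      trans (fromℕ-* c (f n)) (cong (fromℕ c ℚ.*_) (f≡ n m≤n))

  InV-∑ : ∀ {A : Set} {m} {xs : List A} {f : A → ℕ → ℕ} →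
          All (λ x → InV m (f x)) xs → InV m (λ n → ∑[ x ← xs ] f x n)
  InV-∑ []       = InV-0
  InV-∑ (r ∷ rs) = InV-+ r (InV-∑ rs)

  -- The additive hypothesis avoids truncated subtraction; the actual subtraction is done in the
  -- span.
  InV-difference : ∀ {m f g h} → (∀ n → m ≤ n → f n + g n ≡ h n) →
                   InV m g → InV m h → InV m f
  InV-difference {f = f} {g} {h} f+g≡h (inV {g′} Vg′ g≡) (inV {h′} Vh′ h≡) =
    inV (V-+ Vh′ (V-scale (ℚ.- 1ℚ) Vg′)) λ n m≤n → begin
      fromℕ (f n)
        ≡⟨ cancel (fromℕ (f n)) (fromℕ (g n)) ⟩
      (fromℕ (f n) ℚ.+ fromℕ (g n)) ℚ.+ (ℚ.- 1ℚ) ℚ.* fromℕ (g n)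
        ≡⟨ cong₂ (λ x y → x ℚ.+ (ℚ.- 1ℚ) ℚ.* y)
             (trans (sym (fromℕ-+ (f n) (g n))) (trans (cong fromℕ (f+g≡h n m≤n)) (h≡ n m≤n)))
             (g≡ n m≤n) ⟩
      h′ (+ n) ℚ.+ (ℚ.- 1ℚ) ℚ.* g′ (+ n) ∎
    where
    open ≡-Reasoning
    cancel : ∀ x y → x ≡ (x ℚ.+ y) ℚ.+ (ℚ.- 1ℚ) ℚ.* y
    cancel = solve 2 (λ x y → x := (x :+ y) :+ con (ℚ.- 1ℚ) :* y) refl
      where open +-*-Solver

  InV-C*av : ∀ m → InV m (λ n → (n C m) * #positions Π [] (n ∸ m))
  InV-C*av m = let (g , Vg , g≡) = V-C*av m (ℤ.- + m) in inV Vg λ n m≤n → begin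
    fromℕ ((n C m) * #positions Π [] (n ∸ m))
      ≡⟨ fromℕ-* (n C m) (#positions Π [] (n ∸ m)) ⟩
    fromℕ (n C m) ℚ.* fromℕ (#positions Π [] (n ∸ m))
      ≡⟨ cong (λ x → fromℕ (n C m) ℚ.* fromℕ x) (#⟨⨾⟩≡#positions Π [] (n ∸ m)) ⟨
    fromℕ (n C m) ℚ.* fromℕ (av Π (+ (n ∸ m)))
      -- For `m ≤ n` the shift by `- m` in ℤ agrees with the truncated difference `n ∸ m`.
      ≡⟨ cong (λ i → fromℕ (n C m) ℚ.* fromℕ (av Π i))
           (trans (ℤ.m-n≡m⊖n n m) (ℤ.⊖-≥ m≤n)) ⟨
    fromℕ (n C m) ℚ.* fromℕ (av Π (+ n ℤ.+ (ℤ.- + m)))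
      ≡⟨ g≡ n ⟨
    g (+ n) ∎
    where open ≡-Reasoning

  InV-av : InV 0 (#positions Π [])
  InV-av = inV (V-av (+ 0)) λ n _ → begin
    fromℕ (#positions Π [] n)       ≡⟨ cong fromℕ (#⟨⨾⟩≡#positions Π [] n) ⟨
    fromℕ (av Π (+ n))              ≡⟨ cong (λ i → fromℕ (av Π i)) (ℤ.+-identityʳ (+ n)) ⟨
    fromℕ (av Π (+ n ℤ.+ + 0))      ∎
    where open ≡-Reasoning

-- The recurrence and the induction, for patterns of length `2 + k`

module _ {k : ℕ} (Π : List (Vec (Fin (2 + k)) (2 + k))) (nonoverlapping : Nonoverlapping Π) where

  open DecMembership _≟_ using (_∈?_)

  -- The positions straddling the cut after `suc m` entries, in descending order so that `m` is the
  -- head. There are `suc k` of them, one less than the pattern length, unless the start of the word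
  -- leaves room for only `suc m`.
  straddlers : ℕ → List ℕ
  straddlers m = applyUpTo (m ∸_) (suc k ⊓ suc m)

  ∈-straddlers : ∀ m s → s ∈ straddlers m ⇔ Straddles Π (suc m) s
  ∈-straddlers m s = mk⇔ sound complete
    where
    sound : s ∈ straddlers m → Straddles Π (suc m) s
    sound s∈ with ∈-applyUpTo⁻ (m ∸_) s∈
    ... | d , d< , refl = s≤s (m∸n≤m m d) , subst (suc m <_) (sym (+-suc (m ∸ d) (suc k)))
        (s≤s (subst (suc m ≤_) (sym (+-suc (m ∸ d) k)) (s≤s (begin
          m            ≡⟨ m∸n+n≡m (s≤s⁻¹ (<-≤-trans d< (m⊓n≤n (suc k) (suc m)))) ⟨
          m ∸ d + d    ≤⟨ +-monoʳ-≤ (m ∸ d) (s≤s⁻¹ (<-≤-trans d< (m⊓n≤m (suc k) (suc m)))) ⟩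
          m ∸ d + k    ∎))))
      where open ≤-Reasoning
    complete : Straddles Π (suc m) s → s ∈ straddlers m
    complete (s<1+m , 1+m<s+2+k) =
      subst (_∈ straddlers m) (m∸[m∸n]≡n (s≤s⁻¹ s<1+m))
        (∈-applyUpTo⁺ (m ∸_) {n = suc k ⊓ suc m} (⊓-glb (s≤s (m≤n+o⇒m∸n≤o m s m≤s+k)) (s≤s (m∸n≤m m s))))
      where
      m≤s+k : m ≤ s + k
      m≤s+k = s≤s⁻¹ (s≤s⁻¹ (subst (suc (suc m) ≤_)
                (trans (+-suc s (suc k)) (cong suc (+-suc s k))) 1+m<s+2+k))

  straddlers-unique : ∀ m → List.Unique (straddlers m)
  straddlers-unique m = Unique.applyUpTo⁺₁ (m ∸_) (suc k ⊓ suc m) λ i<j j<n →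
    <⇒≢ (∸-monoʳ-< i<j (s≤s⁻¹ (<-≤-trans j<n (m⊓n≤n (suc k) (suc m))))) ∘ sym

  -- straddlers m without its first element m.
  others : ℕ → List ℕ
  others m = applyUpTo (λ d → m ∸ suc d) (k ⊓ m)

  -- `straddlers m` unfolds to `m ∷ others m`, so `#positions-split` at the cut `suc m` exposes the
  -- term for `m ∷ J` that is to be solved for. On the right the factor independent of `n` comes
  -- first, ready for `InV-scale`.
  #positions-recurrence : ∀ m {J} → All (λ s → s + (2 + k) ≤ suc m) J → ∀ n → suc m ≤ n →
    #positions Π (m ∷ J) n + (#positions Π J n + (∑[ s ← others m ] #positions Π (s ∷ J) n)) ≡
    #positions Π J (suc m) * ((n C suc m) * #positions Π [] (n ∸ suc m))
  #positions-recurrence m {J} low n m<n = begin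
    X + (Y + Z)    ≡⟨ trans (sym (+-assoc X Y Z)) (trans (cong (_+ Z) (+-comm X Y)) (+-assoc Y X Z)) ⟩
    Y + (X + Z)    ≡⟨ subst (λ n′ → N J n′ + (∑[ s ← straddlers m ] N (s ∷ J) n′) ≡
                                     (n′ C suc m) * N J (suc m) * N [] (n ∸ suc m))
                        (m+[n∸m]≡n m<n)
                        (#positions-split Π nonoverlapping (suc m) (n ∸ suc m) {straddlers m} {J}
                           z<s (straddlers-unique m) (∈-straddlers m) low) ⟩
    (n C suc m) * N J (suc m) * N [] (n ∸ suc m)
                   ≡⟨ cong (_* N [] (n ∸ suc m)) (*-comm (n C suc m) (N J (suc m))) ⟩
    N J (suc m) * (n C suc m) * N [] (n ∸ suc m)
                   ≡⟨ *-assoc (N J (suc m)) (n C suc m) (N [] (n ∸ suc m)) ⟩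
    N J (suc m) * ((n C suc m) * N [] (n ∸ suc m)) ∎
    where
    open ≡-Reasoning
    N = #positions Π
    X = N (m ∷ J) n
    Y = N J n
    Z = ∑[ s ← others m ] N (s ∷ J) n

  remove : ℕ → List ℕ → List ℕ
  remove m = filter (λ s → ¬? (s ≟ m))

  remove-⊆ : ∀ m {I s} → s ∈ remove m I → s ∈ I
  remove-⊆ m = proj₁ ∘ ∈-filter⁻ (λ s → ¬? (s ≟ m))

  remove-< : ∀ m {I} → All (_< suc m) I → All (_< m) (remove m I)
  remove-< m I≤m = All.tabulate λ s∈J →
    let (s∈I , s≢m) = ∈-filter⁻ (λ s → ¬? (s ≟ m)) s∈J in
    ≤∧≢⇒< (s≤s⁻¹ (All.lookup I≤m s∈I)) s≢m

  ∷-remove : ∀ {m I} → m ∈ I → ∀ s → s ∈ m ∷ remove m I ⇔ s ∈ I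
  ∷-remove {m} {I} m∈I s = mk⇔ (λ { (here refl) → m∈I ; (there s∈J) → remove-⊆ m s∈J }) back
    where
    back : s ∈ I → s ∈ m ∷ remove m I
    back s∈I with s ≟ m
    ... | yes s≡m = here s≡m
    ... | no  s≢m = there (∈-filter⁺ (λ s → ¬? (s ≟ m)) s∈I s≢m)

  others-< : ∀ m → All (_< m) (others m)
  others-< m = All.applyUpTo⁺₁ _ (k ⊓ m) λ {d} d< →
    ∸-monoʳ-< {m} {suc d} {0} z<s (<-≤-trans d< (m⊓n≤n k m))

  -- The strict bound `m` on positions is the bound `m` on indices counted from 1, and also the
  -- threshold for `n`. The induction runs on it rather than on `I`, since the recurrence leads to
  -- sets `s ∷ J` with as many elements as `I` but a smaller bound.
  #positions-InV : ∀ m {I} → All (_< m) I → InV Π m (#positions Π I)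
  #positions-InV zero    []      = InV-av Π
  #positions-InV (suc m) {I} I≤m = decide (m ∈? I) (All.all? (λ s → s + (2 + k) ≤? suc m) J)
    where
    J = remove m I
    decide : Dec (m ∈ I) → Dec (All (λ s → s + (2 + k) ≤ suc m) J) →
             InV Π (suc m) (#positions Π I)
    decide (no m∉I)  _         = InV-≤ Π (n≤1+n m) (#positions-InV m (All.tabulate λ s∈I →
      ≤∧≢⇒< (s≤s⁻¹ (All.lookup I≤m s∈I)) λ { refl → m∉I s∈I }))
    decide (yes m∈I) (no ¬low) =
      let (j , j∈J , j-high) = find (All.¬All⇒Any¬ (λ s → s + (2 + k) ≤? suc m) J ¬low) in
      InV-cong Π (λ n _ → sym (#positions-overlap Π nonoverlapping (remove-⊆ m j∈J) m∈I
                                 (All.lookup (remove-< m I≤m) j∈J) (≰⇒> j-high) n))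
                 (InV-0 Π)
    decide (yes m∈I) (yes low) = InV-cong Π (λ n _ → #positions-cong Π (∷-remove m∈I) n)
      (InV-difference Π (#positions-recurrence m low)
        -- The subtracted terms have all positions below `m`: those of `J`, and the straddling ones
        -- other than `m`.
        (InV-+ Π (InV-≤ Π (n≤1+n m) (#positions-InV m J<m))
                 (InV-∑ Π (All.map (λ s<m → InV-≤ Π (n≤1+n m) (#positions-InV m (s<m ∷ J<m)))
                                   (others-< m))))
        (InV-scale Π (#positions Π J (suc m)) (InV-C*av Π (suc m))))
      where J<m = remove-< m I≤m

theorem6p1 : ∀ (k : ℕ) → 2 ≤ k →
    (Π : List (Vec (Fin k) k)) → All IsPermutation Π → Nonoverlapping Π →
    (I : List ℕ) → All (1 ≤_) I →
    ∃ λ (g : ℤ → ℚ) → V Π g ×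
    (∀ (n : ℕ) → max 0 I + k ∸ 1 ≤ n → (+ (# Π ⟨ I ⨾ n ⟩)) / 1 ≡ g (+ n))
theorem6p1 (suc (suc k)) (s≤s (s≤s z≤n)) Π _ nonoverlapping I I≥1 =
  InV.extension r , InV.member r , λ n max≤n →
    trans (cong fromℕ (#⟨⨾⟩≡#positions Π I≥1 n)) (InV.agrees r n (≤-trans max≤max+k+1 max≤n))
  where
  -- Passing to positions turns the bound `i ≤ max 0 I` on indices into the strict bound that the
  -- induction expects.
  I′<max : All (_< max 0 I) (map pred I)
  I′<max = All.map⁺ (All.zipWith (λ { (s≤s z≤n , i≤max) → i≤max }) (I≥1 , xs≤max 0 I))
  r : InV Π (max 0 I) (#positions Π (map pred I))
  r = #positions-InV Π nonoverlapping (max 0 I) I′<max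
  -- Agreement is known from `max 0 I` on; the stated threshold is larger by `suc k`, the pattern
  -- length less one.
  max≤max+k+1 : max 0 I ≤ max 0 I + (2 + k) ∸ 1
  max≤max+k+1 = subst (max 0 I ≤_) (sym (+-∸-assoc (max 0 I) {2 + k} {1} (s≤s z≤n)))
                      (m≤m+n (max 0 I) (suc k))
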